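{- Let $q\ge 5$ with $q\equiv 1\pmod 4$, and consider the parameter set of the conference graph $C(q)$: a strongly regular graph with $n=q$, $k=(q-1)/2$, $\lambda=(q-5)/4$, $\mu=(q-1)/4$. Then $C(q)$ has a putative skew-symmetric fission scheme with four classes if and only if $q\equiv 5\pmod 8$ and there exist integers $g,h$ with $q=g^2+4h^2$ and $g\equiv 1\pmod 4$.
   Context: Setting: for a 2-class symmetric association scheme whose first nontrivial relation is a strongly regular graph with parameters $(n,k,\lambda,\mu)$, let $k_1=k$, $k_2=n-k-1$ and let its character table be $\begin{pmatrix}1&k_1&k_2\\1&r&t\\1&s&u\end{pmatrix}$ with row multiplicities $1,m_1,m_2$ (for $C(q)$: $r,s=(-1\pm\sqrt q)/2$ in either order, $m_1=m_2=(q-1)/2$). A 4-class skew-symmetric fission scheme has relations $R_0,R_1,R_2,R_2^T,R_1^T$ (only $R_0$ symmetric) with $R_1\cup R_1^T$ and $R_2\cup R_2^T$ the two relations of the 2-class scheme. Its character table (rows = primitive idempotents $E_0,\dots,E_4$ with multiplicities $1,m_1/2,m_2/2,m_2/2,m_1/2$, columns $R_0,R_1,R_2,R_2^T,R_1^T$) has the form $$P=\begin{pmatrix}1&k_1/2&k_2/2&k_2/2&k_1/2\\1&\rho&\tau&\bar\tau&\bar\rho\\1&\sigma&\omega&\bar\omega&\bar\sigma\\1&\bar\sigma&\bar\omega&\omega&\sigma\\1&\bar\rho&\bar\tau&\tau&\rho\end{pmatrix}$$ of one of three types: type I: $\rho=r/2$, $\sigma=(s+\sqrt{ -b})/2$,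 $\tau=(t+\sqrt{ -z})/2$, $\omega=u/2$, $b=nk_1/m_2$, $z=nk_2/m_1$; type II: $\rho=(r+\sqrt{ -y})/2$, $\sigma=s/2$, $\tau=t/2$, $\omega=(u+\sqrt{ -c})/2$, $y=nk_1/m_1$, $c=nk_2/m_2$; type III: $\rho=(r+\sqrt{ -y})/2$, $\tau=(t+\sqrt{ -z})/2$, $\sigma=(s+\sqrt{ -b})/2$, $\omega=(u-\sqrt{ -c})/2$ with $b,c,y,z>0$, $m_1y+m_2b=nk_1$, $m_1z+m_2c=nk_2$, $m_1\sqrt{yz}=m_2\sqrt{bc}$. The numbers $p^{\ell}_{ij}=\frac{1}{nk'_\ell}\sum_{h=0}^4 \mu_h p_{hi}p_{hj}\overline{p_{h\ell}}$ (with $k'_\ell$ the entries of the first row and $\mu_h$ the multiplicities) are the intersection numbers determined by $P$. A "putative" 4-class skew-symmetric fission scheme means such a matrix $P$ (of type I, II or III, for some admissible choice of the free parameters) for which all these intersection numbers are nonnegative integers. -}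

module Defs where

open import Data.Nat as ℕ using (ℕ; zero; suc)
open import Data.Integer as ℤ using (ℤ)
open import Data.Fin using (Fin; zero; suc)
open import Data.Product using (Σ; ∃; ∃-syntax; _×_; _,_; proj₁; proj₂)
open import Data.Sum using (_⊎_)
open import Relation.Binary.PropositionalEquality using (_≡_; _≢_)

-- The real numbers, axiomatised as a (Dedekind-)complete ordered field.
-- Any such structure is isomorphic to ℝ; the main theorem is stated for
-- every such structure (so in particular for ℝ).

record RealField : Set₁ where
  infixl 6 _+_
  infixl 7 _*_
  infix  4 _≤_
  infix  8 -_
  field
    R      : Set
    0# 1#  : R
    _+_    : R → R → R
    _*_    : R → R → R
    -_     : R → R
    _⁻¹    : R → R          -- multiplicative inverse (value at 0# irrelevant)
    _≤_    : R → R → Set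
    +-assoc     : ∀ x y z → (x + y) + z ≡ x + (y + z)
    +-comm      : ∀ x y → x + y ≡ y + x
    +-identityˡ : ∀ x → 0# + x ≡ x
    -‿inverseˡ  : ∀ x → (- x) + x ≡ 0#
    *-assoc     : ∀ x y z → (x * y) * z ≡ x * (y * z)
    *-comm      : ∀ x y → x * y ≡ y * x
    *-identityˡ : ∀ x → 1# * x ≡ x
    distribˡ    : ∀ x y z → x * (y + z) ≡ x * y + x * z
    0≢1         : 0# ≢ 1#
    ⁻¹-inverse  : ∀ x → x ≢ 0# → x * (x ⁻¹) ≡ 1#
    ≤-refl      : ∀ x → x ≤ x
    ≤-trans     : ∀ {x y z} → x ≤ y → y ≤ z → x ≤ z
    ≤-antisym   : ∀ {x y} → x ≤ y → y ≤ x → x ≡ y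
    ≤-total     : ∀ x y → x ≤ y ⊎ y ≤ x
    +-mono-≤    : ∀ {x y} z → x ≤ y → x + z ≤ y + z
    *-nonneg    : ∀ {x y} → 0# ≤ x → 0# ≤ y → 0# ≤ x * y
    sup : (P : R → Set) → ∃ P → (∃ λ b → ∀ x → P x → x ≤ b) →
          ∃ λ s → (∀ x → P x → x ≤ s) × (∀ b → (∀ x → P x → x ≤ b) → s ≤ b)

module Scheme (F : RealField) where
  open RealField F

  infixl 6 _-_
  infixl 7 _/_
  infix 4 _<_
  _-_ : R → R → R
  x - y = x + (- y)

  _/_ : R → R → R
  x / y = x * (y ⁻¹)

  _<_ : R → R → Set
  x < y = (x ≤ y) × (x ≢ y)

  fromℕ : ℕ → R
  fromℕ zero    = 0#
  fromℕ (suc n) = 1# + fromℕ n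

  2# : R
  2# = 1# + 1#

  half : R → R
  half x = x / 2#

  IsSqrt : R → R → Set
  IsSqrt x a = (0# ≤ x) × (x * x ≡ a)

  ℂ : Set
  ℂ = R × R

  re im : ℂ → R
  re = proj₁
  im = proj₂

  ofR : R → ℂ
  ofR x = x , 0#

  _+ᶜ_ : ℂ → ℂ → ℂ
  (a , b) +ᶜ (c , d) = (a + c) , (b + d)

  _*ᶜ_ : ℂ → ℂ → ℂ
  (a , b) *ᶜ (c , d) = (a * c - b * d) , (a * d + b * c)

  conj : ℂ → ℂ
  conj (a , b) = a , (- b)

  _·_ : R → ℂ → ℂ
  x · (a , b) = (x * a) , (x * b)

  Σ5 : (Fin 5 → ℂ) → ℂ
  Σ5 f = f zero +ᶜ (f (suc zero) +ᶜ (f (suc (suc zero)) +ᶜ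
         (f (suc (suc (suc zero))) +ᶜ f (suc (suc (suc (suc zero)))))))

  -- The 5×5 character table of a 4-class skew-symmetric fission scheme,
  -- columns R0, R1, R2, R2ᵀ, R1ᵀ; rows E0..E4.

  valency : (k₁ k₂ : R) → Fin 5 → R
  valency k₁ k₂ zero                                = 1#
  valency k₁ k₂ (suc zero)                          = half k₁
  valency k₁ k₂ (suc (suc zero))                    = half k₂
  valency k₁ k₂ (suc (suc (suc zero)))              = half k₂
  valency k₁ k₂ (suc (suc (suc (suc zero))))        = half k₁

  multiplicity : (m₁ m₂ : R) → Fin 5 → R
  multiplicity m₁ m₂ zero                           = 1#
  multiplicity m₁ m₂ (suc zero)                     = half m₁
  multiplicity m₁ m₂ (suc (suc zero))               = half m₂
  multiplicity m₁ m₂ (suc (suc (suc zero)))         = half m₂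
  multiplicity m₁ m₂ (suc (suc (suc (suc zero))))   = half m₁

  Table : Set
  Table = Fin 5 → Fin 5 → ℂ

  mkP : (k₁ k₂ : R) (ρ σ τ ω : ℂ) → Table
  mkP k₁ k₂ ρ σ τ ω zero    ℓ    = ofR (valency k₁ k₂ ℓ)
  mkP k₁ k₂ ρ σ τ ω (suc i) zero = ofR 1#
  mkP k₁ k₂ ρ σ τ ω (suc zero) (suc zero)                       = ρ
  mkP k₁ k₂ ρ σ τ ω (suc zero) (suc (suc zero))                 = τ
  mkP k₁ k₂ ρ σ τ ω (suc zero) (suc (suc (suc zero)))           = conj τ
  mkP k₁ k₂ ρ σ τ ω (suc zero) (suc (suc (suc (suc zero))))     = conj ρ
  mkP k₁ k₂ ρ σ τ ω (suc (suc zero)) (suc zero)                 = σ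
  mkP k₁ k₂ ρ σ τ ω (suc (suc zero)) (suc (suc zero))           = ω
  mkP k₁ k₂ ρ σ τ ω (suc (suc zero)) (suc (suc (suc zero)))     = conj ω
  mkP k₁ k₂ ρ σ τ ω (suc (suc zero)) (suc (suc (suc (suc zero)))) = conj σ
  mkP k₁ k₂ ρ σ τ ω (suc (suc (suc zero))) (suc zero)           = conj σ
  mkP k₁ k₂ ρ σ τ ω (suc (suc (suc zero))) (suc (suc zero))     = conj ω
  mkP k₁ k₂ ρ σ τ ω (suc (suc (suc zero))) (suc (suc (suc zero))) = ω
  mkP k₁ k₂ ρ σ τ ω (suc (suc (suc zero))) (suc (suc (suc (suc zero)))) = σ
  mkP k₁ k₂ ρ σ τ ω (suc (suc (suc (suc zero)))) (suc zero)       = conj ρ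
  mkP k₁ k₂ ρ σ τ ω (suc (suc (suc (suc zero)))) (suc (suc zero)) = conj τ
  mkP k₁ k₂ ρ σ τ ω (suc (suc (suc (suc zero)))) (suc (suc (suc zero))) = τ
  mkP k₁ k₂ ρ σ τ ω (suc (suc (suc (suc zero)))) (suc (suc (suc (suc zero)))) = ρ

  intersectionNumber : (n k₁ k₂ m₁ m₂ : R) → Table → Fin 5 → Fin 5 → Fin 5 → ℂ
  intersectionNumber n k₁ k₂ m₁ m₂ P i j ℓ =
    (1# / (n * valency k₁ k₂ ℓ)) ·
      Σ5 (λ h → multiplicity m₁ m₂ h · ((P h i *ᶜ P h j) *ᶜ conj (P h ℓ)))

  IsNat : ℂ → Set
  IsNat z = ∃[ N ] z ≡ ofR (fromℕ N)

  AllIntersectionNumbersNat : (n k₁ k₂ m₁ m₂ : R) → Table → Set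
  AllIntersectionNumbersNat n k₁ k₂ m₁ m₂ P =
    ∀ i j ℓ → IsNat (intersectionNumber n k₁ k₂ m₁ m₂ P i j ℓ)

  -- The three types, for a 2-class scheme with data n, k1, k2, m1, m2 and
  -- character table rows (1,k1,k2), (1,r,t), (1,s,u).
  -- √(-x) for x > 0 is i·√x, with √x the nonnegative square root.

  TypeI : (n k₁ k₂ m₁ m₂ r s t u : R) (ρ σ τ ω : ℂ) → Set
  TypeI n k₁ k₂ m₁ m₂ r s t u ρ σ τ ω =
    ∃[ sb ] ∃[ sz ]
      IsSqrt sb ((n * k₁) / m₂) × IsSqrt sz ((n * k₂) / m₁) ×
      (ρ ≡ ofR (half r)) × (σ ≡ (half s , half sb)) ×
      (τ ≡ (half t , half sz)) × (ω ≡ ofR (half u))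

  TypeII : (n k₁ k₂ m₁ m₂ r s t u : R) (ρ σ τ ω : ℂ) → Set
  TypeII n k₁ k₂ m₁ m₂ r s t u ρ σ τ ω =
    ∃[ sy ] ∃[ sc ]
      IsSqrt sy ((n * k₁) / m₁) × IsSqrt sc ((n * k₂) / m₂) ×
      (ρ ≡ (half r , half sy)) × (σ ≡ ofR (half s)) ×
      (τ ≡ ofR (half t)) × (ω ≡ (half u , half sc))

  TypeIII : (n k₁ k₂ m₁ m₂ r s t u : R) (ρ σ τ ω : ℂ) → Set
  TypeIII n k₁ k₂ m₁ m₂ r s t u ρ σ τ ω =
    ∃[ b ] ∃[ c ] ∃[ y ] ∃[ z ] ∃[ sb ] ∃[ sc ] ∃[ sy ] ∃[ sz ]
      (0# < b) × (0# < c) × (0# < y) × (0# < z) ×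
      IsSqrt sb b × IsSqrt sc c × IsSqrt sy y × IsSqrt sz z ×
      (m₁ * y + m₂ * b ≡ n * k₁) × (m₁ * z + m₂ * c ≡ n * k₂) ×
      (m₁ * (sy * sz) ≡ m₂ * (sb * sc)) ×
      (ρ ≡ (half r , half sy)) × (τ ≡ (half t , half sz)) ×
      (σ ≡ (half s , half sb)) × (ω ≡ (half u , - half sc))

  HasPutativeFission : (n k₁ k₂ m₁ m₂ r s t u : R) → Set
  HasPutativeFission n k₁ k₂ m₁ m₂ r s t u =
    ∃[ ρ ] ∃[ σ ] ∃[ τ ] ∃[ ω ]
      (TypeI n k₁ k₂ m₁ m₂ r s t u ρ σ τ ω ⊎
       TypeII n k₁ k₂ m₁ m₂ r s t u ρ σ τ ω ⊎
       TypeIII n k₁ k₂ m₁ m₂ r s t u ρ σ τ ω) ×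
      AllIntersectionNumbersNat n k₁ k₂ m₁ m₂ (mkP k₁ k₂ ρ σ τ ω)

  -- The conference graph parameter set C(q): n = q, k1 = k2 = m1 = m2 =
  -- (q-1)/2, {r, s} = {(-1+√q)/2, (-1-√q)/2} (either order), and the
  -- eigenvalues of the complement are t = -1-r, u = -1-s.

  conferenceFission : (q : ℕ) (sq : R) → Set
  conferenceFission q sq =
    HasPutativeFission nq kq kq kq kq r₊ r₋ (- 1# - r₊) (- 1# - r₋) ⊎
    HasPutativeFission nq kq kq kq kq r₋ r₊ (- 1# - r₋) (- 1# - r₊)
    where
      nq = fromℕ q
      kq = half (fromℕ q - 1#)
      r₊ = half (- 1# + sq)
      r₋ = half (- 1# - sq)

  ConferenceHasPutativeFission : ℕ → Set
  ConferenceHasPutativeFission q =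
    ∃[ sq ] IsSqrt sq (fromℕ q) × conferenceFission q sq

module Submission where

-- For the conference parameters each of the three types gives a table with τ = σ, re ω = re ρ, and
-- imaginary parts c of ρ, d of σ, w of ω satisfying 4 (c² + d²) = q, w² = c², w d = − c d. Setting
-- g = 4 (c² − d²) / √q and h = 4 c d / √q gives q = g² + 4 h², and the intersection numbers
-- with nonzero indices become the cyclotomic numbers of order four
--   16 A = q − 7 + 2 g,  16 B = q + 1 + 2 g − 8 h,  16 C = q + 1 − 6 g,
--   16 D = q + 1 + 2 g + 8 h,  16 E = q − 3 − 2 g.
-- If they are integers, then q = 8 (A + E) + 5, g = 4 (A − E) + 1 and h = D − B. Conversely,
-- q ≡ 5 (mod 8) forces h to be odd, and substituting g = 1 + 4 w and h = 1 + 2 v with v ≥ 0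
-- exhibits all five as natural numbers. The rotation R₁ → R₂ → R₁ᵀ → R₂ᵀ preserves the
-- intersection numbers when ω is the conjugate of ρ, so only ℓ = 0 and ℓ = 1 need be examined.

open import Defs
open import Algebra.Bundles using (CommutativeRing)
import Algebra.Properties.Ring
import Algebra.Properties.Semiring.Mult.TCOptimised
import Algebra.Solver.Ring
open import Algebra.Solver.Ring.AlmostCommutativeRing
  using (fromCommutativeRing; _-Raw-AlmostCommutative⟶_)
open import Data.Empty using (⊥-elim)
open import Data.Fin using (Fin)
open import Data.Fin.Patterns using (0F; 1F; 2F; 3F; 4F)
open import Data.Integer as ℤ using (ℤ; +_; -[1+_]; _⊖_)
import Data.Integer.Properties as ℤ
open import Data.Integer.Solver using (module +-*-Solver)
open import Data.Maybe using (map)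
open import Data.Nat as ℕ using (ℕ; zero; suc; s≤s)
open import Data.Nat.Divisibility using (_∣?_; divides)
open import Data.Nat.DivMod using (m≡m%n+[m/n]*n; [m+kn]%n≡m%n)
import Data.Nat.Properties as ℕ
open import Data.Product using (∃-syntax; _×_; _,_; proj₁; proj₂)
open import Data.Sum using (_⊎_; inj₁; inj₂; [_,_]′)
open import Function using (_∘_)
open import Function.Bundles using (_⇔_; mk⇔)
open import Relation.Binary.PropositionalEquality
open import Relation.Binary.PropositionalEquality.Algebra using (isMagma)
open import Relation.Nullary using (¬_)
open import Relation.Nullary.Decidable using (dec⇒maybe; from-no)

-- With δ = (r - s) / 2 = ± √q / 2, the complex number g + 2 h i equals 2 (c + d i)² / δ. Thus q =
-- g² + 4 h² is a statement about norms, and the converse is the extraction of a complex square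
-- root, which gives c² and d² as (q ± g √q) / 8. Types I and II have c d = 0, hence h = 0. They
-- need no separate exclusion: w d = - c d holds in all three types, and the intersection numbers
-- from which g and h are read involve w only through w d. In the converse, h odd gives c d ≠ 0, so
-- the table found is of type III with positive parameters. Two obstacles shape the proof. Equality
-- in the abstract field is not assumed decidable, so square roots rest on the ¬¬-stability of order
-- and equality, which itself comes from completeness. And a ring solver takes no hypotheses, so
-- each identity that holds modulo the relations between a, b, c, d, w, g, h becomes a free
-- polynomial identity with explicit cofactors.

pronic : ∀ i → ∃[ k ] + k ≡ i ℤ.* i ℤ.+ i
pronic (+ m)      = m ℕ.* m ℕ.+ m , cong (ℤ._+ + m) (ℤ.pos-* m m)
-- The value of i² + i is unchanged by i ↦ -1 - i, so a negative integer takes the witness of its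
-- mirror image.
pronic (-[1+ m ]) = m ℕ.* m ℕ.+ m , trans (cong (ℤ._+ + m) (ℤ.pos-* m m))
  (solve 1 (λ m → m :* m :+ m := :- (con (+ 1) :+ m) :* :- (con (+ 1) :+ m) :+ :- (con (+ 1) :+ m)) refl (+ m))
  where open +-*-Solver

square-abs : ∀ i → i ℤ.* i ≡ + (ℤ.∣ i ∣ ℕ.* ℤ.∣ i ∣)
square-abs (+ m)      = sym (ℤ.pos-* m m)
square-abs (-[1+ m ]) = refl

even⊎odd : ∀ m → ∃[ k ] (m ≡ 2 ℕ.* k ⊎ m ≡ 1 ℕ.+ 2 ℕ.* k)
even⊎odd zero = 0 , inj₁ refl
even⊎odd (suc m) with even⊎odd m
... | k , inj₁ e = k , inj₂ (cong suc e)
... | k , inj₂ e = suc k , inj₁ (trans (cong suc e) (cong suc (sym (ℕ.+-suc k (k ℕ.+ 0)))))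

-- For h = ± 2 v the term 4 h² is 16 v², and (1 + 4 w)² is 1 modulo 8, so q would be 1 instead of 5
-- modulo 8. The two residues differ by 4, which would have to be the multiple 8 t.
q%8≡5⇒h-odd : ∀ q w h → q ℕ.% 8 ≡ 5 →
  + q ≡ (+ 1 ℤ.+ + 4 ℤ.* w) ℤ.* (+ 1 ℤ.+ + 4 ℤ.* w) ℤ.+ + 4 ℤ.* (h ℤ.* h) →
  ∃[ v ] ℤ.∣ h ∣ ≡ 1 ℕ.+ 2 ℕ.* v
q%8≡5⇒h-odd q w h q%8≡5 q≡ with even⊎odd ℤ.∣ h ∣
... | v , inj₂ e = v , e
... | v , inj₁ e = ⊥-elim (4≢8t (cong ℤ.∣_∣ 4≡8t))
  where
  open +-*-Solver
  t : ℤ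
  t = w ℤ.+ + 2 ℤ.* (w ℤ.* w) ℤ.+ + 2 ℤ.* (+ v ℤ.* + v) ℤ.- + (q ℕ./ 8)
  hh≡ : h ℤ.* h ≡ + 2 ℤ.* + v ℤ.* (+ 2 ℤ.* + v)
  hh≡ = trans (square-abs h) (trans (cong (λ x → + (x ℕ.* x)) e)
    (trans (ℤ.pos-* (2 ℕ.* v) (2 ℕ.* v)) (cong (λ x → x ℤ.* x) (ℤ.pos-* 2 v))))
  5+8e≡ : + 5 ℤ.+ + (q ℕ./ 8) ℤ.* + 8
        ≡ (+ 1 ℤ.+ + 4 ℤ.* w) ℤ.* (+ 1 ℤ.+ + 4 ℤ.* w) ℤ.+ + 4 ℤ.* (+ 2 ℤ.* + v ℤ.* (+ 2 ℤ.* + v))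
  5+8e≡ = begin
    + 5 ℤ.+ + (q ℕ./ 8) ℤ.* + 8           ≡⟨ cong (λ x → + 5 ℤ.+ x) (sym (ℤ.pos-* (q ℕ./ 8) 8)) ⟩
    + (5 ℕ.+ q ℕ./ 8 ℕ.* 8)               ≡⟨ cong (λ x → + (x ℕ.+ q ℕ./ 8 ℕ.* 8)) (sym q%8≡5) ⟩
    + (q ℕ.% 8 ℕ.+ q ℕ./ 8 ℕ.* 8)         ≡⟨ cong +_ (sym (m≡m%n+[m/n]*n q 8)) ⟩
    + q
      ≡⟨ trans q≡ (cong (λ x → (+ 1 ℤ.+ + 4 ℤ.* w) ℤ.* (+ 1 ℤ.+ + 4 ℤ.* w) ℤ.+ + 4 ℤ.* x) hh≡) ⟩
    (+ 1 ℤ.+ + 4 ℤ.* w) ℤ.* (+ 1 ℤ.+ + 4 ℤ.* w) ℤ.+ + 4 ℤ.* (+ 2 ℤ.* + v ℤ.* (+ 2 ℤ.* + v)) ∎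
    where open ≡-Reasoning
  4≡8t : + 4 ≡ + 8 ℤ.* t
  4≡8t = begin
    + 4
      ≡⟨ solve 1 (λ e → con (+ 4)
           := con (+ 5) :+ e :* con (+ 8) :- con (+ 1) :- e :* con (+ 8)) refl (+ (q ℕ./ 8)) ⟩
    + 5 ℤ.+ + (q ℕ./ 8) ℤ.* + 8 ℤ.- + 1 ℤ.- + (q ℕ./ 8) ℤ.* + 8
      ≡⟨ cong (λ x → x ℤ.- + 1 ℤ.- + (q ℕ./ 8) ℤ.* + 8) 5+8e≡ ⟩
    (+ 1 ℤ.+ + 4 ℤ.* w) ℤ.* (+ 1 ℤ.+ + 4 ℤ.* w) ℤ.+ + 4 ℤ.* (+ 2 ℤ.* + v ℤ.* (+ 2 ℤ.* + v))
        ℤ.- + 1 ℤ.- + (q ℕ./ 8) ℤ.* + 8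
      ≡⟨ solve 3 (λ w v e → (con (+ 1) :+ con (+ 4) :* w) :* (con (+ 1) :+ con (+ 4) :* w)
             :+ con (+ 4) :* (con (+ 2) :* v :* (con (+ 2) :* v))
             :- con (+ 1) :- e :* con (+ 8)
             := con (+ 8) :* (w :+ con (+ 2) :* (w :* w) :+ con (+ 2) :* (v :* v) :- e))
        refl w (+ v) (+ (q ℕ./ 8)) ⟩
    + 8 ℤ.* t ∎
    where open ≡-Reasoning
  4≢8t : 4 ≢ ℤ.∣ + 8 ℤ.* t ∣
  4≢8t e = from-no (8 ∣? 4) (divides ℤ.∣ t ∣ (trans e (trans (ℤ.abs-* (+ 8) t) (ℕ.*-comm 8 ℤ.∣ t ∣))))

-- Arithmetic in an abstract complete ordered field, and the embedding of the integers.

module FieldArithmetic (F : RealField) where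
  open RealField F
  open Scheme F

  commutativeRing : CommutativeRing _ _
  commutativeRing = record
    { Carrier = R ; _≈_ = _≡_ ; _+_ = _+_ ; _*_ = _*_ ; -_ = -_ ; 0# = 0# ; 1# = 1#
    ; isCommutativeRing = record
      { isRing = record
        { +-isAbelianGroup = record
          { isGroup = record
            { isMonoid = record
              { isSemigroup = record
                { isMagma = isMagma _+_
                ; assoc = +-assoc }
              ; identity = +-identityˡ , λ x → trans (+-comm x 0#) (+-identityˡ x) }
            ; inverse = -‿inverseˡ , λ x → trans (+-comm x (- x)) (-‿inverseˡ x)
            ; ⁻¹-cong = cong (λ z → - z) }
          ; comm = +-comm }
        ; *-cong = cong₂ _*_
        ; *-assoc = *-assoc
        ; *-identity = *-identityˡ , λ x → trans (*-comm x 1#) (*-identityˡ x)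
        ; distrib = distribˡ , λ x y z →
            trans (*-comm (y + z) x) (trans (distribˡ x y z) (cong₂ _+_ (*-comm x y) (*-comm x z))) }
      ; *-comm = *-comm } }

  open CommutativeRing commutativeRing public
    using (semiring; ring; +-identityʳ; *-identityʳ; -‿inverseʳ; zeroˡ; zeroʳ)
  open Algebra.Properties.Ring ring public using (-‿distribˡ-*; -‿distribʳ-*; -‿+-comm; -‿involutive; -0#≈0#)
  open Algebra.Properties.Semiring.Mult.TCOptimised semiring
    using (1+×; ×-homo-+; ×1-homo-*) renaming (_×_ to _times_)

  -- ι (+ 1) and ι (+ 2) reduce to 1# and 2#, so that the ring solver sees these as coefficients.
  ι : ℤ → R
  ι (+ n)      = n times 1#
  ι (-[1+ n ]) = - (suc n times 1#)

  fromℕ≡ι : ∀ n → fromℕ n ≡ ι (+ n)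
  fromℕ≡ι zero    = refl
  fromℕ≡ι (suc n) = trans (cong (λ z → 1# + z) (fromℕ≡ι n)) (sym (1+× n 1#))

  ι-neg : ∀ i → ι (ℤ.- i) ≡ - ι i
  ι-neg (+ zero)   = sym -0#≈0#
  ι-neg (+ suc n)  = refl
  ι-neg (-[1+ n ]) = sym (-‿involutive _)

  private
    ι-⊖ : ∀ m n → ι (m ⊖ n) ≡ ι (+ m) - ι (+ n)
    ι-⊖ m zero = sym (trans (cong (λ z → ι (+ m) + z) -0#≈0#) (+-identityʳ _))
    ι-⊖ zero (suc n) = sym (+-identityˡ _)
    ι-⊖ (suc m) (suc n) = begin
      ι (suc m ⊖ suc n)                     ≡⟨ cong ι (ℤ.[1+m]⊖[1+n]≡m⊖n m n) ⟩
      ι (m ⊖ n)                             ≡⟨ ι-⊖ m n ⟩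
      x - y                                 ≡⟨ cong (_- y) (sym (+-identityʳ x)) ⟩
      x + 0# - y                            ≡⟨ cong (λ z → x + z - y) (sym (-‿inverseʳ 1#)) ⟩
      x + (1# - 1#) - y
        ≡⟨ cong (_- y) (trans (sym (+-assoc x 1# (- 1#))) (cong (_- 1#) (+-comm x 1#))) ⟩
      1# + x - 1# - y                       ≡⟨ +-assoc _ _ _ ⟩
      1# + x + (- 1# - y)
        ≡⟨ cong₂ _+_ (sym (1+× m 1#)) (trans (-‿+-comm 1# y) (cong (λ z → - z) (sym (1+× n 1#)))) ⟩
      ι (+ suc m) - ι (+ suc n)             ∎
      where
      open ≡-Reasoning
      x y : R
      x = ι (+ m)
      y = ι (+ n)

  ι-+ : ∀ i j → ι (i ℤ.+ j) ≡ ι i + ι j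
  ι-+ (+ m)      (+ n)      = ×-homo-+ 1# m n
  ι-+ (+ m)      (-[1+ n ]) = ι-⊖ m (suc n)
  ι-+ (-[1+ m ]) (+ n)      = trans (ι-⊖ n (suc m)) (+-comm _ _)
  ι-+ (-[1+ m ]) (-[1+ n ]) = begin
    - ι (+ suc (suc (m ℕ.+ n)))         ≡⟨ cong (λ k → - ι (+ suc k)) (sym (ℕ.+-suc m n)) ⟩
    - ι (+ (suc m ℕ.+ suc n))           ≡⟨ cong (λ z → - z) (×-homo-+ 1# (suc m) (suc n)) ⟩
    - (ι (+ suc m) + ι (+ suc n))       ≡⟨ sym (-‿+-comm _ _) ⟩
    - ι (+ suc m) - ι (+ suc n)         ∎
    where open ≡-Reasoning

  ι-- : ∀ i j → ι (i ℤ.- j) ≡ ι i - ι j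
  ι-- i j = trans (ι-+ i (ℤ.- j)) (cong (λ z → ι i + z) (ι-neg j))

  private
    ι-+* : ∀ m j → ι (+ m ℤ.* j) ≡ ι (+ m) * ι j
    ι-+* m (+ n)      = trans (cong ι (sym (ℤ.pos-* m n))) (×1-homo-* m n)
    ι-+* m (-[1+ n ]) = begin
      ι (+ m ℤ.* (ℤ.- + suc n))    ≡⟨ cong ι (sym (ℤ.neg-distribʳ-* (+ m) (+ suc n))) ⟩
      ι (ℤ.- (+ m ℤ.* + suc n))    ≡⟨ ι-neg (+ m ℤ.* + suc n) ⟩
      - ι (+ m ℤ.* + suc n)        ≡⟨ cong (λ z → - z) (ι-+* m (+ suc n)) ⟩
      - (ι (+ m) * ι (+ suc n))    ≡⟨ -‿distribʳ-* _ _ ⟩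
      ι (+ m) * (- ι (+ suc n))    ∎
      where open ≡-Reasoning

  ι-* : ∀ i j → ι (i ℤ.* j) ≡ ι i * ι j
  ι-* (+ m)      j = ι-+* m j
  ι-* (-[1+ m ]) j = begin
    ι (ℤ.- (+ suc m) ℤ.* j)    ≡⟨ cong ι (sym (ℤ.neg-distribˡ-* (+ suc m) j)) ⟩
    ι (ℤ.- (+ suc m ℤ.* j))    ≡⟨ ι-neg (+ suc m ℤ.* j) ⟩
    - ι (+ suc m ℤ.* j)        ≡⟨ cong (λ z → - z) (ι-+* (suc m) j) ⟩
    - (ι (+ suc m) * ι j)      ≡⟨ -‿distribˡ-* _ _ ⟩
    - ι (+ suc m) * ι j        ∎
    where open ≡-Reasoning

  private
    ι-morphism : ℤ.+-*-rawRing -Raw-AlmostCommutative⟶ fromCommutativeRing commutativeRing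
    ι-morphism = record
      { ⟦_⟧ = ι ; +-homo = ι-+ ; *-homo = ι-* ; -‿homo = ι-neg ; 0-homo = refl ; 1-homo = refl }

  -- The coefficients are integers because the solver compares coefficients, and equality is
  -- decidable in ℤ but not in `R`.
  open Algebra.Solver.Ring ℤ.+-*-rawRing (fromCommutativeRing commutativeRing) ι-morphism
    (λ i j → map (cong ι) (dec⇒maybe (i ℤ.≟ j))) public
    using (Polynomial; solve; _:=_; _:+_; _:*_; _:-_; :-_; con)


  -- Order, cancellation and stability.

  0≤y-x⇒x≤y : ∀ {x y} → 0# ≤ y - x → x ≤ y
  0≤y-x⇒x≤y {x} {y} p =
    subst₂ _≤_ (+-identityˡ x) (solve 2 (λ x y → y :- x :+ x := y) refl x y) (+-mono-≤ x p)

  x≤y⇒0≤y-x : ∀ {x y} → x ≤ y → 0# ≤ y - x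
  x≤y⇒0≤y-x {x} {y} p = subst (_≤ y - x) (-‿inverseʳ x) (+-mono-≤ (- x) p)

  +-nonneg : ∀ {x y} → 0# ≤ x → 0# ≤ y → 0# ≤ x + y
  +-nonneg {x} {y} p q = ≤-trans q (subst (_≤ x + y) (+-identityˡ y) (+-mono-≤ y p))

  *-monoʳ-≤ : ∀ {k x y} → 0# ≤ k → x ≤ y → k * x ≤ k * y
  *-monoʳ-≤ {k} {x} {y} p q = 0≤y-x⇒x≤y
    (subst (0# ≤_) (solve 3 (λ k x y → k :* (y :- x) := k :* y :- k :* x) refl k x y)
      (*-nonneg p (x≤y⇒0≤y-x q)))

  0≤x² : ∀ x → 0# ≤ x * x
  0≤x² x with ≤-total 0# x
  ... | inj₁ 0≤x = *-nonneg 0≤x 0≤x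
  ... | inj₂ x≤0 = subst (0# ≤_) (solve 1 (λ x → (con (+ 0) :- x) :* (con (+ 0) :- x) := x :* x) refl x)
                     (*-nonneg (x≤y⇒0≤y-x x≤0) (x≤y⇒0≤y-x x≤0))

  0≤1 : 0# ≤ 1#
  0≤1 = subst (0# ≤_) (*-identityˡ 1#) (0≤x² 1#)

  0≤ι+ : ∀ n → 0# ≤ ι (+ n)
  0≤ι+ zero    = ≤-refl 0#
  0≤ι+ (suc n) = subst (0# ≤_) (sym (1+× n 1#)) (+-nonneg 0≤1 (0≤ι+ n))

  ι[1+n]≢0 : ∀ n → ι (+ suc n) ≢ 0#
  ι[1+n]≢0 n eq = 0≢1 (≤-antisym 0≤1 (subst (1# ≤_) eq 1≤ι))
    where
    1≤ι : 1# ≤ ι (+ suc n)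
    1≤ι = 0≤y-x⇒x≤y (subst (0# ≤_)
      (trans (solve 1 (λ x → x := con (+ 1) :+ x :- con (+ 1)) refl (ι (+ n))) (cong (_- 1#) (sym (1+× n 1#))))
      (0≤ι+ n))

  2≢0 : 2# ≢ 0#
  2≢0 = ι[1+n]≢0 1

  0<2 : 0# < 2#
  0<2 = 0≤ι+ 2 , 2≢0 ∘ sym

  -- Characteristic zero: the order keeps `ι` of a positive integer away from 0, so the kernel is
  -- trivial. This carries equations found in `R` back to ℤ.
  ι-injective : ∀ {i j} → ι i ≡ ι j → i ≡ j
  ι-injective {i} {j} eq = ℤ.i-j≡0⇒i≡j i j (kernel (i ℤ.- j) (begin
    ι (i ℤ.- j)        ≡⟨ ι-- i j ⟩
    ι i - ι j          ≡⟨ cong (_- ι j) eq ⟩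
    ι j - ι j          ≡⟨ -‿inverseʳ (ι j) ⟩
    0#                 ∎))
    where
    open ≡-Reasoning
    kernel : ∀ k → ι k ≡ 0# → k ≡ + 0
    kernel (+ zero)   _ = refl
    kernel (+ suc n)  e = ⊥-elim (ι[1+n]≢0 n e)
    kernel (-[1+ n ]) e = ⊥-elim (ι[1+n]≢0 n (trans (sym (-‿involutive _)) (trans (cong (λ z → - z) e) -0#≈0#)))

  *-cancelˡ-≢0 : ∀ {k x y} → k ≢ 0# → k * x ≡ k * y → x ≡ y
  *-cancelˡ-≢0 {k} {x} {y} k≢0 eq = begin
    x                    ≡⟨ unit x ⟨
    k ⁻¹ * (k * x)       ≡⟨ cong (k ⁻¹ *_) eq ⟩
    k ⁻¹ * (k * y)       ≡⟨ unit y ⟩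
    y                    ∎
    where
    open ≡-Reasoning
    unit : ∀ z → k ⁻¹ * (k * z) ≡ z
    unit z = begin
      k ⁻¹ * (k * z)     ≡⟨ solve 3 (λ i k z → i :* (k :* z) := (k :* i) :* z) refl (k ⁻¹) k z ⟩
      (k * k ⁻¹) * z     ≡⟨ cong (_* z) (⁻¹-inverse k k≢0) ⟩
      1# * z             ≡⟨ *-identityˡ z ⟩
      z                  ∎

  xy≡0⇒y≡0 : ∀ {x y} → x ≢ 0# → x * y ≡ 0# → y ≡ 0#
  xy≡0⇒y≡0 {x} x≢0 eq = *-cancelˡ-≢0 x≢0 (trans eq (sym (zeroʳ x)))

  *-≢0 : ∀ {x y} → x ≢ 0# → y ≢ 0# → x * y ≢ 0#
  *-≢0 x≢0 y≢0 = y≢0 ∘ xy≡0⇒y≡0 x≢0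

  *-cancelˡ-≤ : ∀ {k x y} → 0# < k → k * x ≤ k * y → x ≤ y
  *-cancelˡ-≤ {k} {x} {y} (0≤k , 0≢k) p with ≤-total x y
  ... | inj₁ x≤y = x≤y
  ... | inj₂ y≤x = subst (x ≤_) (*-cancelˡ-≢0 (0≢k ∘ sym) (≤-antisym p (*-monoʳ-≤ 0≤k y≤x))) (≤-refl x)

  *-/-cancel : ∀ {k} x → k ≢ 0# → k * (x / k) ≡ x
  *-/-cancel {k} x k≢0 = begin
    k * (x * k ⁻¹)  ≡⟨ solve 3 (λ k x i → k :* (x :* i) := k :* i :* x) refl k x (k ⁻¹) ⟩
    k * k ⁻¹ * x    ≡⟨ cong (_* x) (⁻¹-inverse k k≢0) ⟩
    1# * x          ≡⟨ *-identityˡ x ⟩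
    x               ∎
    where open ≡-Reasoning

  2half : ∀ x → 2# * half x ≡ x
  2half x = *-/-cancel x 2≢0

  x<0⇒half<0 : ∀ {x} → x < 0# → half x < 0#
  x<0⇒half<0 {x} (x≤0 , x≢0) = *-cancelˡ-≤ 0<2 (subst₂ _≤_ (sym (2half x)) (sym (zeroʳ 2#)) x≤0)
    , λ e → x≢0 (trans (sym (2half x)) (trans (cong (2# *_) e) (zeroʳ 2#)))

  -- The supremum of the negative elements is 0#, because doubling it gives another upper bound.
  -- Hence 0# ≤ x may be proved by refuting x ≤ z for z < 0#, which makes the order ¬¬-stable.
  negatives-below⇒nonneg : ∀ x → (∀ z → z < 0# → z ≤ x) → 0# ≤ x
  negatives-below⇒nonneg x below with sup (_< 0#) (- 1# , -1<0) (0# , λ _ → proj₁)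
    where
    -1<0 : - 1# < 0#
    -1<0 = 0≤y-x⇒x≤y (subst (0# ≤_) (solve 0 (con (+ 1) := con (+ 0) :- (:- con (+ 1))) refl) 0≤1)
         , λ e → 0≢1 (trans (sym -0#≈0#) (trans (cong (λ z → - z) (sym e)) (-‿involutive 1#)))
  ... | s , above , least = ≤-trans 0≤s (least x below)
    where
    z≤2s : ∀ z → z < 0# → z ≤ 2# * s
    z≤2s z z<0 = subst (_≤ 2# * s) (2half z) (*-monoʳ-≤ (0≤ι+ 2) (above (half z) (x<0⇒half<0 z<0)))
    0≤s : 0# ≤ s
    0≤s = subst (0# ≤_) (solve 1 (λ s → con (+ 2) :* s :- s := s) refl s) (x≤y⇒0≤y-x (least (2# * s) z≤2s))

  ≤-stable : ∀ {x y} → ¬ ¬ (x ≤ y) → x ≤ y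
  ≤-stable {x} {y} ¬¬p = 0≤y-x⇒x≤y (negatives-below⇒nonneg (y - x) below)
    where
    below : ∀ z → z < 0# → z ≤ y - x
    below z (z≤0 , z≢0) with ≤-total z (y - x)
    ... | inj₁ p = p
    ... | inj₂ p = ⊥-elim (¬¬p λ x≤y → z≢0 (≤-antisym z≤0 (≤-trans (x≤y⇒0≤y-x x≤y) p)))

  ≡-stable : ∀ {x y} → ¬ ¬ (x ≡ y) → x ≡ y
  ≡-stable {x} {y} ¬¬p = ≤-antisym (≤-stable λ ¬q → ¬¬p λ e → ¬q (subst (x ≤_) e (≤-refl x)))
                                   (≤-stable λ ¬q → ¬¬p λ e → ¬q (subst (_≤ x) e (≤-refl x)))

  -- When y ≤ x, the product (x - y)(x + y) is both nonnegative and nonpositive. Whether x - y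
  -- vanishes cannot be decided, but stability allows the assumption that it does not; then x + y =
  -- 0 and y - x = 2 y ≥ 0.
  square-cancel-≤ : ∀ {x y} → 0# ≤ y → x * x ≤ y * y → x ≤ y
  square-cancel-≤ {x} {y} 0≤y xx≤yy with ≤-total x y
  ... | inj₁ x≤y = x≤y
  ... | inj₂ y≤x = ≤-stable λ x≰y → x≰y (0≤y-x⇒x≤y (subst (0# ≤_)
      (begin
        2# * y                   ≡⟨ solve 2 (λ x y → con (+ 2) :* y := y :- x :+ (x :+ y)) refl x y ⟩
        y - x + (x + y)          ≡⟨ cong (λ z → y - x + z) (xy≡0⇒y≡0 (x-y≢0 x≰y) product≡0) ⟩
        y - x + 0#               ≡⟨ +-identityʳ _ ⟩
        y - x                    ∎)
      (*-nonneg (0≤ι+ 2) 0≤y)))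
    where
    open ≡-Reasoning
    0≤x = ≤-trans 0≤y y≤x
    x-y≢0 : ¬ (x ≤ y) → x - y ≢ 0#
    x-y≢0 x≰y e = x≰y (0≤y-x⇒x≤y (subst (0# ≤_)
      (trans (sym -0#≈0#) (trans (cong (λ z → - z) (sym e)) (solve 2 (λ x y → :- (x :- y) := y :- x) refl x y)))
      (≤-refl 0#)))
    factor : (x - y) * (x + y) ≡ x * x - y * y
    factor = solve 2 (λ x y → (x :- y) :* (x :+ y) := x :* x :- y :* y) refl x y
    product≡0 : (x - y) * (x + y) ≡ 0#
    product≡0 = ≤-antisym
      (subst (_≤ 0#) (sym factor) (subst (x * x - y * y ≤_) (-‿inverseʳ (y * y)) (+-mono-≤ (- (y * y)) xx≤yy)))
      (*-nonneg (x≤y⇒0≤y-x y≤x) (+-nonneg 0≤x 0≤y))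

  square-injective : ∀ {x y} → 0# ≤ x → 0# ≤ y → x * x ≡ y * y → x ≡ y
  square-injective {x} {y} 0≤x 0≤y e = ≤-antisym
    (square-cancel-≤ 0≤y (subst (x * x ≤_) e (≤-refl _)))
    (square-cancel-≤ 0≤x (subst (_≤ x * x) e (≤-refl _)))

  IsSqrt-unique : ∀ {x y a} → IsSqrt x a → IsSqrt y a → x ≡ y
  IsSqrt-unique (0≤x , p) (0≤y , q) = square-injective 0≤x 0≤y (trans p (sym q))

  -- Square roots from suprema.

  a≤[1+a]² : ∀ {a} → 0# ≤ a → a ≤ (1# + a) * (1# + a)
  a≤[1+a]² {a} 0≤a = 0≤y-x⇒x≤y (subst (0# ≤_)
    (solve 1 (λ a → con (+ 1) :+ a :+ a :* a := (con (+ 1) :+ a) :* (con (+ 1) :+ a) :- a) refl a)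
    (+-nonneg (+-nonneg 0≤1 0≤a) (0≤x² a)))

  sqrt : ∀ {a} → 0# ≤ a → ∃[ x ] IsSqrt x a
  sqrt {a} 0≤a with sup (λ x → x * x ≤ a) (0# , subst (_≤ a) (sym (zeroˡ 0#)) 0≤a)
                     (1# + a , λ x xx≤a → square-cancel-≤ (+-nonneg 0≤1 0≤a) (≤-trans xx≤a (a≤[1+a]² 0≤a)))
  -- Stability allows `s * s ≢ a` to be assumed. This excludes s = 0, so that `root` may divide by
  -- s.
  ... | s , above , least = s , 0≤s , ≡-stable (λ ss≢a → ss≢a (root (s≢0 ss≢a)))
    where
    0≤s : 0# ≤ s
    0≤s = above 0# (subst (_≤ a) (sym (zeroˡ 0#)) 0≤a)

    upper : ∀ {y} → 0# ≤ y → a ≤ y * y → s ≤ y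
    upper {y} 0≤y a≤yy = least y λ x xx≤a → square-cancel-≤ 0≤y (≤-trans xx≤a a≤yy)

    -- (a / y)² = a² / y² ≤ a, so a / y belongs to the set whose supremum is s.
    lower : ∀ {y} → 0# < y → a ≤ y * y → a ≤ y * s
    lower {y} (0≤y , 0≢y) a≤yy = subst (_≤ y * s) (*-/-cancel a y≢0) (*-monoʳ-≤ 0≤y (above (a / y)
      (*-cancelˡ-≤ {y * y} (0≤x² y , *-≢0 y≢0 y≢0 ∘ sym)
        (subst₂ _≤_ (sym [a/y]²) (*-comm a (y * y)) (*-monoʳ-≤ 0≤a a≤yy)))))
      where
      open ≡-Reasoning
      y≢0 = 0≢y ∘ sym
      [a/y]² : y * y * (a / y * (a / y)) ≡ a * a
      [a/y]² = begin
        y * y * (a / y * (a / y))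
          ≡⟨ solve 2 (λ y z → y :* y :* (z :* z) := y :* z :* (y :* z)) refl y (a / y) ⟩
        y * (a / y) * (y * (a / y))    ≡⟨ cong₂ _*_ (*-/-cancel a y≢0) (*-/-cancel a y≢0) ⟩
        a * a                          ∎

    0<1+a : 0# < 1# + a
    0<1+a = +-nonneg 0≤1 0≤a , λ e → 0≢1 (≤-antisym 0≤1 (subst (1# ≤_) (sym e)
      (0≤y-x⇒x≤y (subst (0# ≤_) (solve 1 (λ a → a := con (+ 1) :+ a :- con (+ 1)) refl a) 0≤a))))

    -- If s were 0, `lower` at 1 + a would give a ≤ 0, hence a = 0 = s².
    s≢0 : s * s ≢ a → s ≢ 0#
    s≢0 ss≢a s≡0 = ss≢a (trans (cong (_* s) s≡0) (trans (zeroˡ s) (≤-antisym 0≤a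
      (subst (a ≤_) (trans (cong ((1# + a) *_) s≡0) (zeroʳ _)) (lower 0<1+a (a≤[1+a]² 0≤a))))))

    -- The Newton step (s + a / s) / 2 overestimates √a, and is therefore at least s, while a
    -- divided by it is at most s; these two facts give s * s ≤ a and a ≤ s * s.
    root : s ≢ 0# → s * s ≡ a
    root s≢0 = ≤-antisym ss≤a a≤ss
      where
      open ≡-Reasoning
      u y : R
      u = a / s
      y = half (s + u)
      su≡a : s * u ≡ a
      su≡a = *-/-cancel a s≢0
      2y≡s+u : 2# * y ≡ s + u
      2y≡s+u = 2half (s + u)
      0≤u : 0# ≤ u
      0≤u = *-cancelˡ-≤ (0≤s , s≢0 ∘ sym) (subst₂ _≤_ (sym (zeroʳ s)) (sym su≡a) 0≤a)
      0≤y : 0# ≤ y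
      0≤y = *-cancelˡ-≤ 0<2 (subst₂ _≤_ (sym (zeroʳ 2#)) (sym 2y≡s+u) (+-nonneg 0≤s 0≤u))
      y≢0 : y ≢ 0#
      y≢0 y≡0 = s≢0 (≤-antisym (0≤y-x⇒x≤y (subst (0# ≤_) u≡-s 0≤u)) 0≤s)
        where
        u≡-s : u ≡ 0# - s
        u≡-s = begin
          u                ≡⟨ solve 2 (λ s u → u := s :+ u :- s) refl s u ⟩
          s + u - s        ≡⟨ cong (_- s) (trans (sym 2y≡s+u) (trans (cong (2# *_) y≡0) (zeroʳ 2#))) ⟩
          0# - s           ∎
      -- The inequality of arithmetic and geometric means: 4 (y² - a) = (s - u)².
      a≤yy : a ≤ y * y
      a≤yy = *-cancelˡ-≤ {ι (+ 4)} (0≤ι+ 4 , ι[1+n]≢0 3 ∘ sym) (0≤y-x⇒x≤y (subst (0# ≤_)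
        (begin
          (s - u) * (s - u)
            ≡⟨ solve 2 (λ s u → (s :- u) :* (s :- u)
                 := (s :+ u) :* (s :+ u) :- con (+ 4) :* (s :* u)) refl s u ⟩
          (s + u) * (s + u) - ι (+ 4) * (s * u)
            ≡⟨ cong₂ (λ p q → p * p - ι (+ 4) * q) (sym 2y≡s+u) su≡a ⟩
          2# * y * (2# * y) - ι (+ 4) * a
            ≡⟨ solve 2 (λ y a → con (+ 2) :* y :* (con (+ 2) :* y) :- con (+ 4) :* a
                                := con (+ 4) :* (y :* y) :- con (+ 4) :* a) refl y a ⟩
          ι (+ 4) * (y * y) - ι (+ 4) * a ∎)
        (0≤x² (s - u))))
      ss≤a : s * s ≤ a
      ss≤a = subst (s * s ≤_) su≡a (*-monoʳ-≤ 0≤s (0≤y-x⇒x≤y (subst (0# ≤_)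
        (begin
          2# * (y - s)         ≡⟨ solve 2 (λ y s → con (+ 2) :* (y :- s) := con (+ 2) :* y :- s :- s) refl y s ⟩
          2# * y - s - s       ≡⟨ cong (λ z → z - s - s) 2y≡s+u ⟩
          s + u - s - s        ≡⟨ solve 2 (λ s u → s :+ u :- s :- s := u :- s) refl s u ⟩
          u - s                ∎)
        (*-nonneg (0≤ι+ 2) (x≤y⇒0≤y-x (upper 0≤y a≤yy))))))
      a≤ss : a ≤ s * s
      a≤ss = 0≤y-x⇒x≤y (subst (0# ≤_)
        (begin
          2# * (y * s - a)
            ≡⟨ solve 3 (λ y s a → con (+ 2) :* (y :* s :- a) := con (+ 2) :* y :* s :- a :- a) refl y s a ⟩
          2# * y * s - a - a                  ≡⟨ cong₂ (λ p q → p * s - q - a) 2y≡s+u (sym su≡a) ⟩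
          (s + u) * s - s * u - a
            ≡⟨ solve 3 (λ s u a → (s :+ u) :* s :- s :* u :- a := s :* s :- a) refl s u a ⟩
          s * s - a                           ∎)
        (*-nonneg (0≤ι+ 2) (x≤y⇒0≤y-x (lower (0≤y , y≢0 ∘ sym) a≤yy))))

-- The intersection numbers with nonzero indices are (q + α + β g + γ h) / 16, where q = g² + 4 h²,
-- for one of five coefficient triples: the cyclotomic numbers of order four. The κᵢ are cofactors
-- in the polynomial identity from which this formula follows.
record Cyclotomic : Set where
  constructor cyclotomic
  field α β γ κ₁ κ₂ κ₃ κ₄ : ℤ

-- The cofactors of the relations for h and for w d are nonzero only in `cycB` and `cycD`, the two
-- numbers that involve h. Replacing h by -h exchanges these two.
cycA cycB cycC cycD cycE : Cyclotomic
cycA = cyclotomic (ℤ.- + 7) (+ 2) (+ 0) (+ 16) (+ 8) (+ 0) (+ 0)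
cycB = cyclotomic (+ 1) (+ 2) (ℤ.- + 8) (ℤ.- + 16) (+ 8) (ℤ.- + 32) (ℤ.- + 64)
cycC = cyclotomic (+ 1) (ℤ.- + 6) (+ 0) (ℤ.- + 48) (ℤ.- + 24) (+ 0) (+ 0)
cycD = cyclotomic (+ 1) (+ 2) (+ 8) (ℤ.- + 16) (+ 8) (+ 32) (+ 64)
cycE = cyclotomic (ℤ.- + 3) (ℤ.- + 2) (+ 0) (+ 16) (ℤ.- + 8) (+ 0) (+ 0)

module Fission (F : RealField) where
  open RealField F
  open Scheme F
  open FieldArithmetic F

  -- Intersection numbers as real sums over two rows.

  module FissionTable (n K : R) (ρ σ τ ω : ℂ) where

    P : Table
    P = mkP K K ρ σ τ ω

    val : Fin 5 → R
    val = valency K K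

    p : Fin 5 → Fin 5 → Fin 5 → ℂ
    p = intersectionNumber n K K K K P

    tri : ℂ → ℂ → ℂ → R
    tri x y z = re ((x *ᶜ y) *ᶜ conj z)

    -- Rows 4 and 3 are the conjugates of rows 1 and 2, and all four have multiplicity `half K`.
    -- Their imaginary parts therefore cancel, and together they contribute
    -- `2# * (half K * T i j ℓ)`.
    T : Fin 5 → Fin 5 → Fin 5 → R
    T i j ℓ = tri (P 1F i) (P 1F j) (P 1F ℓ)
            + tri (P 2F i) (P 2F j) (P 2F ℓ)

    conj-involutive : ∀ x → conj (conj x) ≡ x
    conj-involutive (x , y) = cong (x ,_) (-‿involutive y)

    row₃ : ∀ i → P 3F i ≡ conj (P 2F i)
    row₃ 0F = cong (1# ,_) (sym -0#≈0#)
    row₃ 1F = refl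
    row₃ 2F = refl
    row₃ 3F = sym (conj-involutive ω)
    row₃ 4F = sym (conj-involutive σ)

    row₄ : ∀ i → P 4F i ≡ conj (P 1F i)
    row₄ 0F = cong (1# ,_) (sym -0#≈0#)
    row₄ 1F = refl
    row₄ 2F = refl
    row₄ 3F = sym (conj-involutive τ)
    row₄ 4F = sym (conj-involutive ρ)

    private
      term : R → ℂ → ℂ → ℂ → ℂ
      term m x y z = m · ((x *ᶜ y) *ᶜ conj z)

      term-conj : ∀ m x y z → term m (conj x) (conj y) (conj z) ≡ conj (term m x y z)
      term-conj m (x , x′) (y , y′) (z , z′) = cong₂ _,_
        (solve 7 (λ m x x′ y y′ z z′ →
           m :* ((x :* y :- (:- x′) :* (:- y′)) :* z :- (x :* (:- y′) :+ (:- x′) :* y) :* (:- (:- z′)))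
           := m :* ((x :* y :- x′ :* y′) :* z :- (x :* y′ :+ x′ :* y) :* (:- z′))) refl m x x′ y y′ z z′)
        (solve 7 (λ m x x′ y y′ z z′ →
           m :* ((x :* y :- (:- x′) :* (:- y′)) :* (:- (:- z′)) :+ (x :* (:- y′) :+ (:- x′) :* y) :* z)
           := :- (m :* ((x :* y :- x′ :* y′) :* (:- z′) :+ (x :* y′ :+ x′ :* y) :* z))) refl m x x′ y y′ z z′)

      term-real : ∀ x y z → term 1# (ofR x) (ofR y) (ofR z) ≡ ofR (x * y * z)
      term-real x y z = cong₂ _,_
        (solve 3 (λ x y z → con (+ 1) :* ((x :* y :- con (+ 0) :* con (+ 0)) :* z
                              :- (x :* con (+ 0) :+ con (+ 0) :* y) :* (:- con (+ 0))) := x :* y :* z) refl x y z)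
        (solve 3 (λ x y z → con (+ 1) :* ((x :* y :- con (+ 0) :* con (+ 0)) :* (:- con (+ 0))
                              :+ (x :* con (+ 0) :+ con (+ 0) :* y) :* z) := con (+ 0)) refl x y z)

      palindrome : ∀ t m x y → ofR t +ᶜ ((m · x) +ᶜ ((m · y) +ᶜ (conj (m · y) +ᶜ conj (m · x))))
                                 ≡ ofR (t + 2# * (m * (re x + re y)))
      palindrome t m (x , x′) (y , y′) = cong₂ _,_
        (solve 4 (λ t m x y → t :+ (m :* x :+ (m :* y :+ (m :* y :+ m :* x)))
             := t :+ con (+ 2) :* (m :* (x :+ y))) refl t m x y)
        (solve 3 (λ m x y → con (+ 0) :+ (m :* x :+ (m :* y :+ (:- (m :* y) :+ :- (m :* x))))
             := con (+ 0)) refl m x′ y′)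

    total : Fin 5 → Fin 5 → Fin 5 → R
    total i j ℓ = val i * val j * val ℓ + 2# * (half K * T i j ℓ)

    p≡total : ∀ i j ℓ → p i j ℓ ≡ ofR ((1# / (n * val ℓ)) * total i j ℓ)
    p≡total i j ℓ = trans (cong ((1# / (n * val ℓ)) ·_) sum≡total)
      (cong ((1# / (n * val ℓ)) * total i j ℓ ,_) (zeroʳ _))
      where
      open ≡-Reasoning
      f₁ f₂ : ℂ
      f₁ = term (half K) (P 1F i) (P 1F j) (P 1F ℓ)
      f₂ = term (half K) (P 2F i) (P 2F j) (P 2F ℓ)
      f₃≡f₂* : term (half K) (P 3F i) (P 3F j) (P 3F ℓ) ≡ conj f₂
      f₃≡f₂* rewrite row₃ i | row₃ j | row₃ ℓ = term-conj (half K) (P 2F i) (P 2F j) (P 2F ℓ)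
      f₄≡f₁* : term (half K) (P 4F i) (P 4F j) (P 4F ℓ) ≡ conj f₁
      f₄≡f₁* rewrite row₄ i | row₄ j | row₄ ℓ = term-conj (half K) (P 1F i) (P 1F j) (P 1F ℓ)
      sum≡total : Σ5 (λ h → multiplicity K K h · ((P h i *ᶜ P h j) *ᶜ conj (P h ℓ))) ≡ ofR (total i j ℓ)
      sum≡total = trans
        (cong₂ _+ᶜ_ (term-real (val i) (val j) (val ℓ))
          (cong (f₁ +ᶜ_) (cong (f₂ +ᶜ_) (cong₂ _+ᶜ_ f₃≡f₂* f₄≡f₁*))))
        (palindrome _ (half K) _ _)

    val≢0 : K ≢ 0# → ∀ ℓ → val ℓ ≢ 0#
    val≢0 K≢0 ℓ e = [ (λ q → 0≢1 (sym (trans (sym q) e))) , (λ q → K≢0 (trans (sym (2half K))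
        (trans (cong (2# *_) (trans (sym q) e)) (zeroʳ 2#)))) ]′ (cases ℓ)
      where
      cases : ∀ ℓ → val ℓ ≡ 1# ⊎ val ℓ ≡ half K
      cases 0F = inj₁ refl
      cases 1F = inj₂ refl
      cases 2F = inj₂ refl
      cases 3F = inj₂ refl
      cases 4F = inj₂ refl

    module _ (n≢0 : n ≢ 0#) (K≢0 : K ≢ 0#) where

      total⇒p : ∀ i j ℓ {x} → total i j ℓ ≡ n * val ℓ * x → p i j ℓ ≡ ofR x
      total⇒p i j ℓ {x} e = trans (p≡total i j ℓ) (cong ofR (begin
        (1# / m) * total i j ℓ    ≡⟨ cong ((1# / m) *_) e ⟩
        (1# * m ⁻¹) * (m * x)
          ≡⟨ solve 3 (λ i m x → (con (+ 1) :* i) :* (m :* x) := (m :* i) :* x) refl (m ⁻¹) m x ⟩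
        m * m ⁻¹ * x              ≡⟨ cong (_* x) (⁻¹-inverse m (*-≢0 n≢0 (val≢0 K≢0 ℓ))) ⟩
        1# * x                    ≡⟨ *-identityˡ x ⟩
        x                         ∎))
        where
        open ≡-Reasoning
        m : R
        m = n * val ℓ

      p⇒total : ∀ i j ℓ {x} → p i j ℓ ≡ ofR x → total i j ℓ ≡ n * val ℓ * x
      p⇒total i j ℓ {x} e = sym (begin
        m * x                     ≡⟨ cong (λ z → m * proj₁ z) (trans (sym e) (p≡total i j ℓ)) ⟩
        m * ((1# / m) * total i j ℓ)
          ≡⟨ solve 3 (λ i m t → m :* ((con (+ 1) :* i) :* t) := (m :* i) :* t) refl (m ⁻¹) m (total i j ℓ) ⟩
        m * m ⁻¹ * total i j ℓ    ≡⟨ cong (_* total i j ℓ) (⁻¹-inverse m (*-≢0 n≢0 (val≢0 K≢0 ℓ))) ⟩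
        1# * total i j ℓ          ≡⟨ *-identityˡ _ ⟩
        total i j ℓ               ∎)
        where
        open ≡-Reasoning
        m : R
        m = n * val ℓ

    IsNat-swap : ∀ i j ℓ → IsNat (p i j ℓ) → IsNat (p j i ℓ)
    IsNat-swap i j ℓ (N , e) = N , trans (p≡total j i ℓ)
      (trans (cong (λ t → ofR ((1# / (n * val ℓ)) * t)) total-swap) (trans (sym (p≡total i j ℓ)) e))
      where
      tri-swap : ∀ x y z → tri y x z ≡ tri x y z
      tri-swap (x , x′) (y , y′) (z , z′) =
        solve 6 (λ x x′ y y′ z z′ → (y :* x :- y′ :* x′) :* z :- (y :* x′ :+ y′ :* x) :* (:- z′)
                                 := (x :* y :- x′ :* y′) :* z :- (x :* y′ :+ x′ :* y) :* (:- z′)) refl x x′ y y′ z z′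
      total-swap : total j i ℓ ≡ total i j ℓ
      total-swap = cong₂ (λ a b → a * val ℓ + 2# * (half K * b)) (*-comm (val j) (val i))
        (cong₂ _+_ (tri-swap (P 1F i) (P 1F j) (P 1F ℓ)) (tri-swap (P 2F i) (P 2F j) (P 2F ℓ)))

  -- Tables of conference type and their cyclotomic numbers.

  module ConferenceTable
    (n K a b c d w G H : R)
    -- With a = r / 2 and b = s / 2, the first three hypotheses are r + s = -1, q = (r - s)² and r s
    -- = - K / 2, and `norm` is c² + d² = q / 4. The number 1 stands alone so that it can be
    -- rewritten as a linear form; G and H are tied to c and d by products, not quotients, as the
    -- ring solver requires.
    (a+b : 1# ≡ - (2# * (a + b)))
    (n≡ : n ≡ 2# * 2# * ((a - b) * (a - b)))
    (K/2≡ : half K ≡ - (2# * 2# * (a * b)))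
    (norm : c * c + d * d ≡ (a - b) * (a - b))
    (G≡ : 2# * (c * c - d * d) ≡ (a - b) * G)
    (H≡ : 2# * (c * d) ≡ (a - b) * H)
    (wd : w * d ≡ - (c * d))
    where
    open FissionTable n K (a , c) (b , d) (b , d) (a , w)

    sixteenfold : Cyclotomic → R
    sixteenfold N = n + ι α + ι β * G + ι γ * H
      where open Cyclotomic N

    -- For three nonzero indices the intersection number is `half K * (half K * half K + 2# * t)`
    -- divided by `n * half K`. Cancelling `half K` and multiplying by 16 n turns "16 times this
    -- number is `sixteenfold N`" into the present equation, which is free of division by n.
    Balanced : Cyclotomic → R → Set
    Balanced N t = ι (+ 16) * (half K * half K + 2# * t) ≡ n * sixteenfold N

    module _ (N : Cyclotomic) {t : R} where
      open Cyclotomic N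
      private
        -- `o`, `v` and `q` are 1, `half K` and n as forms of degree 1, 2 and 2 in a and b. With c,
        -- d, w, G, H of degree 1, the powers of `o` bring every term of the identity to degree
        -- four.
        δ o v q : R
        δ = a - b
        o = - (2# * (a + b))
        v = - (2# * 2# * (a * b))
        q = 2# * 2# * (δ * δ)

      -- With 1# homogenised to − 2 (a + b), the identity lies in the ideal generated by the four
      -- remaining relations.
      balance :
        ι (+ 16) * (v * v + o * (2# * t)) ≡
          q * (q + ι α * (o * o) + ι β * o * G + ι γ * o * H)
            + ι κ₁ * o * (a + b) * (c * c + d * d - δ * δ) + ι κ₂ * o * δ * (2# * (c * c - d * d) - δ * G)
            + ι κ₃ * o * δ * (2# * (c * d) - δ * H) + ι κ₄ * o * b * (w * d + c * d) →
        Balanced N t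
      balance e = begin
        ι (+ 16) * (half K * half K + 2# * t)
          ≡⟨ cong₂ (λ x y → ι (+ 16) * (x * x + y)) K/2≡
               (trans (sym (*-identityˡ _)) (cong (_* (2# * t)) a+b)) ⟩
        ι (+ 16) * (v * v + o * (2# * t))
          ≡⟨ trans e (vanish norm G≡ H≡ wd) ⟩
        q * (q + ι α * (o * o) + ι β * o * G + ι γ * o * H)
          ≡⟨ cong₂ (λ x y → x * (x + ι α * (y * y) + ι β * y * G + ι γ * y * H)) (sym n≡) (sym a+b) ⟩
        n * (n + ι α * (1# * 1#) + ι β * 1# * G + ι γ * 1# * H)
          ≡⟨ solve 6 (λ n α β γ G H →
               n :* (n :+ α :* (con (+ 1) :* con (+ 1)) :+ β :* con (+ 1) :* G :+ γ :* con (+ 1) :* H)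
               := n :* (n :+ α :+ β :* G :+ γ :* H)) refl n (ι α) (ι β) (ι γ) G H ⟩
        n * (n + ι α + ι β * G + ι γ * H) ∎
        where
        open ≡-Reasoning
        vanish : ∀ {r k₁ k₂ k₃ k₄ x₁ y₁ x₂ y₂ x₃ y₃ x y} → x₁ ≡ y₁ → x₂ ≡ y₂ → x₃ ≡ y₃ → x ≡ - y →
          r + k₁ * (x₁ - y₁) + k₂ * (x₂ - y₂) + k₃ * (x₃ - y₃) + k₄ * (x + y) ≡ r
        vanish {r} {k₁} {k₂} {k₃} {k₄} {x₁} {x₂ = x₂} {x₃ = x₃} {y = y} refl refl refl refl =
          solve 9 (λ r k₁ k₂ k₃ k₄ x₁ x₂ x₃ y → r :+ k₁ :* (x₁ :- x₁) :+ k₂ :* (x₂ :- x₂) :+ k₃ :* (x₃ :- x₃)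
                     :+ k₄ :* (:- y :+ y) := r) refl r k₁ k₂ k₃ k₄ x₁ x₂ x₃ y

      count⇒total : ∀ {x} → Balanced N t → ι (+ 16) * x ≡ sixteenfold N →
        half K * half K * half K + 2# * (half K * t) ≡ n * half K * x
      count⇒total {x} balanced e = *-cancelˡ-≢0 (ι[1+n]≢0 15) (begin
        ι (+ 16) * (u * u * u + 2# * (u * t))
          ≡⟨ solve 2 (λ u t → con (+ 16) :* (u :* u :* u :+ con (+ 2) :* (u :* t))
              := u :* (con (+ 16) :* (u :* u :+ con (+ 2) :* t))) refl u t ⟩
        u * (ι (+ 16) * (u * u + 2# * t))        ≡⟨ cong (u *_) (trans balanced (cong (n *_) (sym e))) ⟩
        u * (n * (ι (+ 16) * x))
          ≡⟨ solve 3 (λ u n x → u :* (n :* (con (+ 16) :* x)) := con (+ 16) :* (n :* u :* x)) refl u n x ⟩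
        ι (+ 16) * (n * u * x)                   ∎)
        where
        open ≡-Reasoning
        u = half K

      total⇒count : ∀ {x} → n * half K ≢ 0# → Balanced N t →
        half K * half K * half K + 2# * (half K * t) ≡ n * half K * x → ι (+ 16) * x ≡ sixteenfold N
      total⇒count {x} nu≢0 balanced e = *-cancelˡ-≢0 nu≢0 (begin
        n * u * (ι (+ 16) * x)
          ≡⟨ solve 3 (λ u n x → n :* u :* (con (+ 16) :* x) := con (+ 16) :* (n :* u :* x)) refl u n x ⟩
        ι (+ 16) * (n * u * x)                   ≡⟨ cong (ι (+ 16) *_) (sym e) ⟩
        ι (+ 16) * (u * u * u + 2# * (u * t))
          ≡⟨ solve 2 (λ u t → con (+ 16) :* (u :* u :* u :+ con (+ 2) :* (u :* t))
              := u :* (con (+ 16) :* (u :* u :+ con (+ 2) :* t))) refl u t ⟩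
        u * (ι (+ 16) * (u * u + 2# * t))        ≡⟨ cong (u *_) balanced ⟩
        u * (n * sixteenfold N)  ≡⟨ solve 3 (λ u n x → u :* (n :* x) := n :* u :* x) refl u n (sixteenfold N) ⟩
        n * u * sixteenfold N    ∎)
        where
        open ≡-Reasoning
        u = half K

    -- Solver syntax for the hypothesis of `balance`, uniform in the three indices. The entries are
    -- polynomials rather than variables, so that w can be instantiated by -c.
    module Symbolic {m} (a b c d w G H : Polynomial m) where
      δ o v q : Polynomial m
      δ = a :- b
      o = :- (con (+ 2) :* (a :+ b))
      v = :- (con (+ 2) :* con (+ 2) :* (a :* b))
      q = con (+ 2) :* con (+ 2) :* (δ :* δ)

      tri′ : (x y z : Polynomial m × Polynomial m) → Polynomial m
      tri′ (x , x′) (y , y′) (z , z′) = (x :* y :- x′ :* y′) :* z :- (x :* y′ :+ x′ :* y) :* (:- z′)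

      row₁ row₂ : Fin 5 → Polynomial m × Polynomial m
      row₁ 0F = con (+ 1) , con (+ 0)
      row₁ 1F = a , c
      row₁ 2F = b , d
      row₁ 3F = b , :- d
      row₁ 4F = a , :- c
      row₂ 0F = con (+ 1) , con (+ 0)
      row₂ 1F = b , d
      row₂ 2F = a , w
      row₂ 3F = a , :- w
      row₂ 4F = b , :- d

      T′ : Fin 5 → Fin 5 → Fin 5 → Polynomial m
      T′ i j ℓ = tri′ (row₁ i) (row₁ j) (row₁ ℓ) :+ tri′ (row₂ i) (row₂ j) (row₂ ℓ)

      balance′ : (i j ℓ : Fin 5) → Cyclotomic → Polynomial m × Polynomial m
      balance′ i j ℓ (cyclotomic α β γ κ₁ κ₂ κ₃ κ₄) =
        con (+ 16) :* (v :* v :+ o :* (con (+ 2) :* T′ i j ℓ)) :=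
          q :* (q :+ con α :* (o :* o) :+ con β :* o :* G :+ con γ :* o :* H)
            :+ con κ₁ :* o :* (a :+ b) :* (c :* c :+ d :* d :- δ :* δ)
            :+ con κ₂ :* o :* δ :* (con (+ 2) :* (c :* c :- d :* d) :- δ :* G)
            :+ con κ₃ :* o :* δ :* (con (+ 2) :* (c :* d) :- δ :* H) :+ con κ₄ :* o :* b :* (w :* d :+ c :* d)

    -- After expansion, these four sums contain w only in the product w d, so the single relation
    -- `wd` serves all three types. The values A and E determine n and G, and B and D determine H.
    T₁₁₁ : Balanced cycA (T 1F 1F 1F)
    T₁₁₁ = balance cycA (solve 7 (λ a b c d w G H → Symbolic.balance′ a b c d w G H
      1F 1F 1F cycA) refl a b c d w G H)

    T₁₂₁ : Balanced cycE (T 1F 2F 1F)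
    T₁₂₁ = balance cycE (solve 7 (λ a b c d w G H → Symbolic.balance′ a b c d w G H
      1F 2F 1F cycE) refl a b c d w G H)

    T₁₁₂ : Balanced cycD (T 1F 1F 2F)
    T₁₁₂ = balance cycD (solve 7 (λ a b c d w G H → Symbolic.balance′ a b c d w G H
      1F 1F 2F cycD) refl a b c d w G H)

    T₁₁₃ : Balanced cycB (T 1F 1F 3F)
    T₁₁₃ = balance cycB (solve 7 (λ a b c d w G H → Symbolic.balance′ a b c d w G H
      1F 1F 3F cycB) refl a b c d w G H)

    -- Necessity: integrality of n, G and H.

    module Integrality (n≢0 : n ≢ 0#) (K≢0 : K ≢ 0#) (δ≢0 : a - b ≢ 0#)
      (integral : AllIntersectionNumbersNat n K K K K P) where

      private
        open ≡-Reasoning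
        N : Fin 5 → Fin 5 → Fin 5 → ℕ
        N i j ℓ = proj₁ (integral i j ℓ)

        N-total : ∀ i j ℓ → total i j ℓ ≡ n * val ℓ * ι (+ N i j ℓ)
        N-total i j ℓ = p⇒total n≢0 K≢0 i j ℓ (trans (proj₂ (integral i j ℓ)) (cong ofR (fromℕ≡ι (N i j ℓ))))

        nK/2≢0 : n * half K ≢ 0#
        nK/2≢0 = *-≢0 n≢0 (val≢0 K≢0 1F)

        A B D E : ℕ
        A = N 1F 1F 1F
        B = N 1F 1F 3F
        D = N 1F 1F 2F
        E = N 1F 2F 1F

        16A : ι (+ 16) * ι (+ A) ≡ sixteenfold cycA
        16A = total⇒count cycA nK/2≢0 T₁₁₁ (N-total 1F 1F 1F)
        16B : ι (+ 16) * ι (+ B) ≡ sixteenfold cycB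
        16B = total⇒count cycB nK/2≢0 T₁₁₃ (N-total 1F 1F 3F)
        16D : ι (+ 16) * ι (+ D) ≡ sixteenfold cycD
        16D = total⇒count cycD nK/2≢0 T₁₁₂ (N-total 1F 1F 2F)
        16E : ι (+ 16) * ι (+ E) ≡ sixteenfold cycE
        16E = total⇒count cycE nK/2≢0 T₁₂₁ (N-total 1F 2F 1F)

      e : ℕ
      e = A ℕ.+ E

      w′ g h : ℤ
      w′ = + A ℤ.- + E
      g = + 1 ℤ.+ + 4 ℤ.* w′
      h = + D ℤ.- + B

      n≡8e+5 : n ≡ ι (+ 5 ℤ.+ + e ℤ.* + 8)
      n≡8e+5 = *-cancelˡ-≢0 2≢0 (begin
        2# * n
          ≡⟨ solve 3 (λ n G H → con (+ 2) :* n :=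
               (n :+ con (ℤ.- + 7) :+ con (+ 2) :* G :+ con (+ 0) :* H)
               :+ (n :+ con (ℤ.- + 3) :+ con (ℤ.- + 2) :* G :+ con (+ 0) :* H) :+ con (+ 10)) refl n G H ⟩
        sixteenfold cycA + sixteenfold cycE + ι (+ 10)
          ≡⟨ cong₂ (λ x y → x + y + ι (+ 10)) (sym 16A) (sym 16E) ⟩
        ι (+ 16) * ι (+ A) + ι (+ 16) * ι (+ E) + ι (+ 10)
          ≡⟨ solve 2 (λ A E → con (+ 16) :* A :+ con (+ 16) :* E :+ con (+ 10)
               := con (+ 2) :* (con (+ 5) :+ (A :+ E) :* con (+ 8))) refl (ι (+ A)) (ι (+ E)) ⟩
        2# * (ι (+ 5) + (ι (+ A) + ι (+ E)) * ι (+ 8))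
          ≡⟨ cong (λ x → 2# * (ι (+ 5) + x * ι (+ 8))) (sym (ι-+ (+ A) (+ E))) ⟩
        2# * (ι (+ 5) + ι (+ e) * ι (+ 8))
          ≡⟨ cong (λ x → 2# * (ι (+ 5) + x)) (sym (ι-* (+ e) (+ 8))) ⟩
        2# * (ι (+ 5) + ι (+ e ℤ.* + 8))
          ≡⟨ cong (2# *_) (sym (ι-+ (+ 5) (+ e ℤ.* + 8))) ⟩
        2# * ι (+ 5 ℤ.+ + e ℤ.* + 8) ∎)

      G≡ιg : G ≡ ι g
      G≡ιg = *-cancelˡ-≢0 (ι[1+n]≢0 3) (begin
        ι (+ 4) * G
          ≡⟨ solve 3 (λ n G H → con (+ 4) :* G :=
               (n :+ con (ℤ.- + 7) :+ con (+ 2) :* G :+ con (+ 0) :* H)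
               :- (n :+ con (ℤ.- + 3) :+ con (ℤ.- + 2) :* G :+ con (+ 0) :* H) :+ con (+ 4)) refl n G H ⟩
        sixteenfold cycA - sixteenfold cycE + ι (+ 4)
          ≡⟨ cong₂ (λ x y → x - y + ι (+ 4)) (sym 16A) (sym 16E) ⟩
        ι (+ 16) * ι (+ A) - ι (+ 16) * ι (+ E) + ι (+ 4)
          ≡⟨ solve 2 (λ A E → con (+ 16) :* A :- con (+ 16) :* E :+ con (+ 4)
               := con (+ 4) :* (con (+ 1) :+ con (+ 4) :* (A :- E))) refl (ι (+ A)) (ι (+ E)) ⟩
        ι (+ 4) * (1# + ι (+ 4) * (ι (+ A) - ι (+ E)))
          ≡⟨ cong (λ x → ι (+ 4) * (1# + ι (+ 4) * x)) (sym (ι-- (+ A) (+ E))) ⟩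
        ι (+ 4) * (1# + ι (+ 4) * ι w′)
          ≡⟨ cong (λ x → ι (+ 4) * (1# + x)) (sym (ι-* (+ 4) w′)) ⟩
        ι (+ 4) * (1# + ι (+ 4 ℤ.* w′))
          ≡⟨ cong (ι (+ 4) *_) (sym (ι-+ (+ 1) (+ 4 ℤ.* w′))) ⟩
        ι (+ 4) * ι g ∎)

      H≡ιh : H ≡ ι h
      H≡ιh = *-cancelˡ-≢0 (ι[1+n]≢0 15) (begin
        ι (+ 16) * H
          ≡⟨ solve 3 (λ n G H → con (+ 16) :* H :=
               (n :+ con (+ 1) :+ con (+ 2) :* G :+ con (+ 8) :* H)
               :- (n :+ con (+ 1) :+ con (+ 2) :* G :+ con (ℤ.- + 8) :* H)) refl n G H ⟩
        sixteenfold cycD - sixteenfold cycB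
          ≡⟨ cong₂ _-_ (sym 16D) (sym 16B) ⟩
        ι (+ 16) * ι (+ D) - ι (+ 16) * ι (+ B)
          ≡⟨ solve 2 (λ D B → con (+ 16) :* D :- con (+ 16) :* B
               := con (+ 16) :* (D :- B)) refl (ι (+ D)) (ι (+ B)) ⟩
        ι (+ 16) * (ι (+ D) - ι (+ B))
          ≡⟨ cong (ι (+ 16) *_) (sym (ι-- (+ D) (+ B))) ⟩
        ι (+ 16) * ι h ∎)

      -- G + 2 H i is 2 (c + d i)² / δ, whose norm is 4 (c² + d²)² / δ² = 4 δ² = n. The computation
      -- is carried out after multiplication by δ².
      n≡G²+4H² : n ≡ G * G + ι (+ 4) * (H * H)
      n≡G²+4H² = *-cancelˡ-≢0 (*-≢0 δ≢0 δ≢0) (begin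
        δ * δ * n
          ≡⟨ trans (cong (δ * δ *_) n≡) (solve 1 (λ s → s :* (con (+ 2) :* con (+ 2) :* s)
               := con (+ 4) :* (s :* s)) refl (δ * δ)) ⟩
        ι (+ 4) * (δ * δ * (δ * δ))
          ≡⟨ cong (λ x → ι (+ 4) * (x * x)) (sym norm) ⟩
        ι (+ 4) * ((c * c + d * d) * (c * c + d * d))
          ≡⟨ solve 2 (λ c d → con (+ 4) :* ((c :* c :+ d :* d) :* (c :* c :+ d :* d)) :=
                con (+ 2) :* (c :* c :- d :* d) :* (con (+ 2) :* (c :* c :- d :* d))
                :+ con (+ 4) :* (con (+ 2) :* (c :* d) :* (con (+ 2) :* (c :* d)))) refl c d ⟩
        2# * (c * c - d * d) * (2# * (c * c - d * d)) + ι (+ 4) * (2# * (c * d) * (2# * (c * d)))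
          ≡⟨ cong₂ (λ x y → x * x + ι (+ 4) * (y * y)) G≡ H≡ ⟩
        δ * G * (δ * G) + ι (+ 4) * (δ * H * (δ * H))
          ≡⟨ solve 3 (λ δ G H → δ :* G :* (δ :* G) :+ con (+ 4) :* (δ :* H :* (δ :* H))
                := δ :* δ :* (G :* G :+ con (+ 4) :* (H :* H))) refl δ G H ⟩
        δ * δ * (G * G + ι (+ 4) * (H * H)) ∎)
        where
        δ = a - b

      n≡g²+4h² : n ≡ ι (g ℤ.* g ℤ.+ + 4 ℤ.* (h ℤ.* h))
      n≡g²+4h² = begin
        n                                             ≡⟨ n≡G²+4H² ⟩
        G * G + ι (+ 4) * (H * H)                     ≡⟨ cong₂ (λ x y → x * x + ι (+ 4) * (y * y)) G≡ιg H≡ιh ⟩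
        ι g * ι g + ι (+ 4) * (ι h * ι h)             ≡⟨ cong (λ x → ι g * ι g + ι (+ 4) * x) (sym (ι-* h h)) ⟩
        ι g * ι g + ι (+ 4) * ι (h ℤ.* h)             ≡⟨ cong₂ _+_ (sym (ι-* g g)) (sym (ι-* (+ 4) (h ℤ.* h))) ⟩
        ι (g ℤ.* g) + ι (+ 4 ℤ.* (h ℤ.* h))           ≡⟨ sym (ι-+ (g ℤ.* g) (+ 4 ℤ.* (h ℤ.* h))) ⟩
        ι (g ℤ.* g ℤ.+ + 4 ℤ.* (h ℤ.* h))             ∎

  -- Sufficiency: all intersection numbers of a table with cyclic symmetry.

  module CyclicTable
    (n K a b c d G H : R)
    (a+b : 1# ≡ - (2# * (a + b)))
    (n≡ : n ≡ 2# * 2# * ((a - b) * (a - b)))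
    (K/2≡ : half K ≡ - (2# * 2# * (a * b)))
    (norm : c * c + d * d ≡ (a - b) * (a - b))
    (G≡ : 2# * (c * c - d * d) ≡ (a - b) * G)
    (H≡ : 2# * (c * d) ≡ (a - b) * H)
    (n≢0 : n ≢ 0#) (K≢0 : K ≢ 0#)
    where
    open FissionTable n K (a , c) (b , d) (b , d) (a , - c)
    open ConferenceTable n K a b c d (- c) G H a+b n≡ K/2≡ norm G≡ H≡ (sym (-‿distribˡ-* c d))

    rot : Fin 5 → Fin 5
    rot 0F = 0F
    rot 1F = 2F
    rot 2F = 4F
    rot 3F = 1F
    rot 4F = 3F

    private
      row₁-rot : ∀ i → P 1F (rot i) ≡ P 2F i
      row₁-rot 0F = refl
      row₁-rot 1F = refl
      row₁-rot 2F = refl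
      row₁-rot 3F = sym (conj-involutive _)
      row₁-rot 4F = refl

      row₂-rot : ∀ i → P 2F (rot i) ≡ conj (P 1F i)
      row₂-rot 0F = cong (1# ,_) (sym -0#≈0#)
      row₂-rot 1F = refl
      row₂-rot 2F = refl
      row₂-rot 3F = sym (conj-involutive _)
      row₂-rot 4F = refl

      val-rot : ∀ i → val (rot i) ≡ val i
      val-rot 0F = refl
      val-rot 1F = refl
      val-rot 2F = refl
      val-rot 3F = refl
      val-rot 4F = refl

      tri-conj : ∀ x y z → tri (conj x) (conj y) (conj z) ≡ tri x y z
      tri-conj (x , x′) (y , y′) (z , z′) =
        solve 6 (λ x x′ y y′ z z′ →
          (x :* y :- (:- x′) :* (:- y′)) :* z :- (x :* (:- y′) :+ (:- x′) :* y) :* (:- (:- z′))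
          := (x :* y :- x′ :* y′) :* z :- (x :* y′ :+ x′ :* y) :* (:- z′)) refl x x′ y y′ z z′

      -- The rotation turns row 1 into row 2 and row 2 into the conjugate of row 1. Conjugation
      -- preserves the real part of a triple product, so the two summands merely change places.
      T-rot : ∀ i j ℓ → T (rot i) (rot j) (rot ℓ) ≡ T i j ℓ
      T-rot i j ℓ
        rewrite row₁-rot i | row₁-rot j | row₁-rot ℓ | row₂-rot i | row₂-rot j | row₂-rot ℓ =
        trans (cong₂ _+_ refl (tri-conj (P 1F i) (P 1F j) (P 1F ℓ))) (+-comm _ _)

    p-rot : ∀ i j ℓ → p (rot i) (rot j) (rot ℓ) ≡ p i j ℓ
    p-rot i j ℓ = begin
      p (rot i) (rot j) (rot ℓ)
        ≡⟨ p≡total (rot i) (rot j) (rot ℓ) ⟩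
      ofR ((1# / (n * val (rot ℓ))) * total (rot i) (rot j) (rot ℓ))
        ≡⟨ cong₂ (λ v t → ofR ((1# / (n * v)) * t)) (val-rot ℓ)
             (cong₂ (λ v t → v + 2# * (half K * t))
               (cong₂ _*_ (cong₂ _*_ (val-rot i) (val-rot j)) (val-rot ℓ)) (T-rot i j ℓ)) ⟩
      ofR ((1# / (n * val ℓ)) * total i j ℓ)
        ≡⟨ sym (p≡total i j ℓ) ⟩
      p i j ℓ ∎
      where open ≡-Reasoning

    total⇒IsNat : ∀ i j ℓ N → total i j ℓ ≡ n * val ℓ * ι (+ N) → IsNat (p i j ℓ)
    total⇒IsNat i j ℓ N e = N , trans (total⇒p n≢0 K≢0 i j ℓ e) (cong ofR (sym (fromℕ≡ι N)))

    -- Column orthogonality of the character table, with one factor `half K` cancelled. ε is 1 when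
    -- the two columns agree, one of them being transposed if ℓ = 0, and is 0 otherwise.
    Orthogonal : ℤ → R → Set
    Orthogonal ε t = half K + 2# * t ≡ ι ε * n

    module _ (ε κ : ℤ) where
      orthogonal : ∀ {t} → - (2# * 2# * (a * b)) + 2# * t
          ≡ ι ε * (2# * 2# * ((a - b) * (a - b))) + ι κ * (c * c + d * d - (a - b) * (a - b)) → Orthogonal ε t
      orthogonal {t} e = begin
        half K + 2# * t
          ≡⟨ trans (cong (_+ 2# * t) K/2≡) e ⟩
        ι ε * (2# * 2# * ((a - b) * (a - b))) + ι κ * (c * c + d * d - (a - b) * (a - b))
          ≡⟨ cong₂ (λ x y → ι ε * x + ι κ * (y - (a - b) * (a - b))) (sym n≡) norm ⟩
        ι ε * n + ι κ * ((a - b) * (a - b) - (a - b) * (a - b))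
          ≡⟨ solve 4 (λ ε n κ x → ε :* n :+ κ :* (x :- x) := ε :* n) refl (ι ε) n (ι κ) ((a - b) * (a - b)) ⟩
        ι ε * n ∎
        where open ≡-Reasoning

    orthogonal′ : ∀ {m} (a b c d : Polynomial m) → (i j ℓ : Fin 5) → ℤ → ℤ → Polynomial m × Polynomial m
    orthogonal′ a b c d i j ℓ ε κ = v :+ con (+ 2) :* T′ i j ℓ
      := con ε :* q :+ con κ :* (c :* c :+ d :* d :- δ :* δ)
      where open Symbolic a b c d (:- c) (con (+ 0)) (con (+ 0))


    module _ (V A B C D E : ℕ) (V≡ : half K ≡ ι (+ V))
      (16A : ι (+ 16) * ι (+ A) ≡ sixteenfold cycA)
      (16B : ι (+ 16) * ι (+ B) ≡ sixteenfold cycB)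
      (16C : ι (+ 16) * ι (+ C) ≡ sixteenfold cycC)
      (16D : ι (+ 16) * ι (+ D) ≡ sixteenfold cycD)
      (16E : ι (+ 16) * ι (+ E) ≡ sixteenfold cycE) where

      private
        1+2[a+b]≡0 : 1# + 2# * (a + b) ≡ 0#
        1+2[a+b]≡0 = trans (cong (_+ 2# * (a + b)) a+b) (-‿inverseˡ (2# * (a + b)))

        n≡1+2K : n ≡ 1# + 2# * K
        n≡1+2K = begin
          n                                                ≡⟨ n≡ ⟩
          2# * 2# * ((a - b) * (a - b))
            ≡⟨ solve 2 (λ a b → con (+ 2) :* con (+ 2) :* ((a :- b) :* (a :- b)) :=
              (:- (con (+ 2) :* (a :+ b))) :* (:- (con (+ 2) :* (a :+ b)))
              :+ con (+ 4) :* (:- (con (+ 2) :* con (+ 2) :* (a :* b)))) refl a b ⟩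
          - (2# * (a + b)) * - (2# * (a + b)) + ι (+ 4) * - (2# * 2# * (a * b))
              ≡⟨ cong₂ (λ x y → x * x + ι (+ 4) * y) (sym a+b) (sym K/2≡) ⟩
          1# * 1# + ι (+ 4) * half K
            ≡⟨ solve 1 (λ v → con (+ 1) :* con (+ 1) :+ con (+ 4) :* v
              := con (+ 1) :+ con (+ 2) :* (con (+ 2) :* v)) refl (half K) ⟩
          1# + 2# * (2# * half K)                          ≡⟨ cong (λ x → 1# + 2# * x) (2half K) ⟩
          1# + 2# * K                                      ∎
          where open ≡-Reasoning

        IsNat₀₀₀ : IsNat (p 0F 0F 0F)
        IsNat₀₀₀ = total⇒IsNat 0F 0F 0F 1 (begin
          1# * 1# * 1# + 2# * (half K * T 0F 0F 0F)
            ≡⟨ solve 1 (λ v →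
                 con (+ 1) :* con (+ 1) :* con (+ 1) :+ con (+ 2) :* (v :* Symbolic.T′ O O O O O O O 0F 0F 0F)
                 := con (+ 1) :+ con (+ 2) :* (con (+ 2) :* v)) refl (half K) ⟩
          1# + 2# * (2# * half K)
            ≡⟨ trans (cong (λ x → 1# + 2# * x) (2half K)) (sym n≡1+2K) ⟩
          n
            ≡⟨ solve 1 (λ n → n := n :* con (+ 1) :* con (+ 1)) refl n ⟩
          n * 1# * 1# ∎)
          where
          open ≡-Reasoning
          O : Polynomial 1
          O = con (+ 0)

        IsNat₀₀₁ : IsNat (p 0F 0F 1F)
        IsNat₀₀₁ = total⇒IsNat 0F 0F 1F 0 (begin
          1# * 1# * half K + 2# * (half K * T 0F 0F 1F)
            ≡⟨ solve 5 (λ v a b c d →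
                 con (+ 1) :* con (+ 1) :* v
                 :+ con (+ 2) :* (v :* Symbolic.T′ a b c d (:- c) (con (+ 0)) (con (+ 0)) 0F 0F 1F)
                 := v :* (con (+ 1) :+ con (+ 2) :* (a :+ b))) refl (half K) a b c d ⟩
          half K * (1# + 2# * (a + b))
            ≡⟨ cong (half K *_) 1+2[a+b]≡0 ⟩
          half K * 0#
            ≡⟨ trans (zeroʳ _) (sym (zeroʳ _)) ⟩
          n * half K * 0# ∎)
          where open ≡-Reasoning

        IsNat₀₁₀ : IsNat (p 0F 1F 0F)
        IsNat₀₁₀ = total⇒IsNat 0F 1F 0F 0 (begin
          1# * half K * 1# + 2# * (half K * T 0F 1F 0F)
            ≡⟨ solve 5 (λ v a b c d →
                 con (+ 1) :* v :* con (+ 1)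
                 :+ con (+ 2) :* (v :* Symbolic.T′ a b c d (:- c) (con (+ 0)) (con (+ 0)) 0F 1F 0F)
                 := v :* (con (+ 1) :+ con (+ 2) :* (a :+ b))) refl (half K) a b c d ⟩
          half K * (1# + 2# * (a + b))
            ≡⟨ cong (half K *_) 1+2[a+b]≡0 ⟩
          half K * 0#
            ≡⟨ trans (zeroʳ _) (sym (zeroʳ _)) ⟩
          n * 1# * 0# ∎)
          where open ≡-Reasoning

        IsNat-orthogonal₁ : ∀ ε j → val j ≡ half K → Orthogonal (+ ε) (T 0F j 1F) → IsNat (p 0F j 1F)
        IsNat-orthogonal₁ ε j v≡ e = total⇒IsNat 0F j 1F ε (begin
          1# * val j * half K + 2# * (half K * T 0F j 1F)
            ≡⟨ cong (λ v → 1# * v * half K + 2# * (half K * T 0F j 1F)) v≡ ⟩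
          1# * half K * half K + 2# * (half K * T 0F j 1F)
            ≡⟨ solve 2 (λ v t → con (+ 1) :* v :* v :+ con (+ 2) :* (v :* t)
                 := v :* (v :+ con (+ 2) :* t)) refl (half K) (T 0F j 1F) ⟩
          half K * (half K + 2# * T 0F j 1F)
            ≡⟨ cong (half K *_) e ⟩
          half K * (ι (+ ε) * n)
            ≡⟨ solve 3 (λ v ε n → v :* (ε :* n) := n :* v :* ε) refl (half K) (ι (+ ε)) n ⟩
          n * half K * ι (+ ε) ∎)
          where open ≡-Reasoning

        -- At ℓ = 0 the intersection number is ε times the valency `half K`; this is where the
        -- natural number V enters.
        IsNat-orthogonal₀ : ∀ ε i → val i ≡ half K → Orthogonal (+ ε) (T i 1F 0F) → IsNat (p i 1F 0F)
        IsNat-orthogonal₀ ε i v≡ e = total⇒IsNat i 1F 0F (ε ℕ.* V) (begin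
          val i * half K * 1# + 2# * (half K * T i 1F 0F)
            ≡⟨ cong (λ v → v * half K * 1# + 2# * (half K * T i 1F 0F)) v≡ ⟩
          half K * half K * 1# + 2# * (half K * T i 1F 0F)
            ≡⟨ solve 2 (λ v t → v :* v :* con (+ 1) :+ con (+ 2) :* (v :* t)
                 := v :* (v :+ con (+ 2) :* t)) refl (half K) (T i 1F 0F) ⟩
          half K * (half K + 2# * T i 1F 0F)
            ≡⟨ cong₂ _*_ V≡ e ⟩
          ι (+ V) * (ι (+ ε) * n)
            ≡⟨ solve 3 (λ v ε n → v :* (ε :* n) := n :* con (+ 1) :* (ε :* v)) refl (ι (+ V)) (ι (+ ε)) n ⟩
          n * 1# * (ι (+ ε) * ι (+ V))
            ≡⟨ cong (n * 1# *_) (trans (sym (ι-* (+ ε) (+ V))) (cong ι (sym (ℤ.pos-* ε V)))) ⟩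
          n * 1# * ι (+ (ε ℕ.* V)) ∎)
          where open ≡-Reasoning

      IsNat-p₀ : ∀ i → IsNat (p i 1F 0F)
      IsNat-p₀ 0F = IsNat₀₁₀
      IsNat-p₀ 1F = IsNat-orthogonal₀ 0 1F refl
        (orthogonal (+ 0) (ℤ.- + 2) (solve 4 (λ a b c d → orthogonal′ a b c d 1F 1F 0F (+ 0) (ℤ.- + 2))
          refl a b c d))
      IsNat-p₀ 2F = IsNat-orthogonal₀ 0 2F refl
        (orthogonal (+ 0) (+ 0) (solve 4 (λ a b c d → orthogonal′ a b c d 2F 1F 0F (+ 0) (+ 0)) refl a b c d))
      IsNat-p₀ 3F = IsNat-orthogonal₀ 0 3F refl
        (orthogonal (+ 0) (+ 0) (solve 4 (λ a b c d → orthogonal′ a b c d 3F 1F 0F (+ 0) (+ 0)) refl a b c d))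
      IsNat-p₀ 4F = IsNat-orthogonal₀ 1 4F refl
        (orthogonal (+ 1) (+ 2) (solve 4 (λ a b c d → orthogonal′ a b c d 4F 1F 0F (+ 1) (+ 2)) refl a b c d))

      IsNat-p₀₁ : ∀ j → IsNat (p 0F j 1F)
      IsNat-p₀₁ 0F = IsNat₀₀₁
      IsNat-p₀₁ 1F = IsNat-orthogonal₁ 1 1F refl
        (orthogonal (+ 1) (+ 2) (solve 4 (λ a b c d → orthogonal′ a b c d 0F 1F 1F (+ 1) (+ 2)) refl a b c d))
      IsNat-p₀₁ 2F = IsNat-orthogonal₁ 0 2F refl
        (orthogonal (+ 0) (+ 0) (solve 4 (λ a b c d → orthogonal′ a b c d 0F 2F 1F (+ 0) (+ 0)) refl a b c d))
      IsNat-p₀₁ 3F = IsNat-orthogonal₁ 0 3F refl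
        (orthogonal (+ 0) (+ 0) (solve 4 (λ a b c d → orthogonal′ a b c d 0F 3F 1F (+ 0) (+ 0)) refl a b c d))
      IsNat-p₀₁ 4F = IsNat-orthogonal₁ 0 4F refl
        (orthogonal (+ 0) (ℤ.- + 2) (solve 4 (λ a b c d → orthogonal′ a b c d 0F 4F 1F (+ 0) (ℤ.- + 2))
          refl a b c d))

      -- Symmetry in i and j leaves ten entries with nonzero indices. They form the array of
      -- cyclotomic numbers of order four, in which C occurs only at i = j = 4.
      IsNat-p₁ : ∀ i j → IsNat (p i j 1F)
      IsNat-p₁ 0F j = IsNat-p₀₁ j
      IsNat-p₁ 1F 0F = IsNat-swap 0F 1F 1F (IsNat-p₀₁ 1F)
      IsNat-p₁ 1F 1F = total⇒IsNat 1F 1F 1F A (count⇒total cycA (balance cycA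
        (solve 6 (λ a b c d G H → Symbolic.balance′ a b c d (:- c) G H 1F 1F 1F cycA) refl a b c d G H)) 16A)
      IsNat-p₁ 1F 2F = total⇒IsNat 1F 2F 1F E (count⇒total cycE (balance cycE
        (solve 6 (λ a b c d G H → Symbolic.balance′ a b c d (:- c) G H 1F 2F 1F cycE) refl a b c d G H)) 16E)
      IsNat-p₁ 1F 3F = total⇒IsNat 1F 3F 1F E (count⇒total cycE (balance cycE
        (solve 6 (λ a b c d G H → Symbolic.balance′ a b c d (:- c) G H 1F 3F 1F cycE) refl a b c d G H)) 16E)
      IsNat-p₁ 1F 4F = total⇒IsNat 1F 4F 1F A (count⇒total cycA (balance cycA
        (solve 6 (λ a b c d G H → Symbolic.balance′ a b c d (:- c) G H 1F 4F 1F cycA) refl a b c d G H)) 16A)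
      IsNat-p₁ 2F 0F = IsNat-swap 0F 2F 1F (IsNat-p₀₁ 2F)
      IsNat-p₁ 2F 1F = IsNat-swap 1F 2F 1F (IsNat-p₁ 1F 2F)
      IsNat-p₁ 2F 2F = total⇒IsNat 2F 2F 1F B (count⇒total cycB (balance cycB
        (solve 6 (λ a b c d G H → Symbolic.balance′ a b c d (:- c) G H 2F 2F 1F cycB) refl a b c d G H)) 16B)
      IsNat-p₁ 2F 3F = total⇒IsNat 2F 3F 1F E (count⇒total cycE (balance cycE
        (solve 6 (λ a b c d G H → Symbolic.balance′ a b c d (:- c) G H 2F 3F 1F cycE) refl a b c d G H)) 16E)
      IsNat-p₁ 2F 4F = total⇒IsNat 2F 4F 1F D (count⇒total cycD (balance cycD
        (solve 6 (λ a b c d G H → Symbolic.balance′ a b c d (:- c) G H 2F 4F 1F cycD) refl a b c d G H)) 16D)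
      IsNat-p₁ 3F 0F = IsNat-swap 0F 3F 1F (IsNat-p₀₁ 3F)
      IsNat-p₁ 3F 1F = IsNat-swap 1F 3F 1F (IsNat-p₁ 1F 3F)
      IsNat-p₁ 3F 2F = IsNat-swap 2F 3F 1F (IsNat-p₁ 2F 3F)
      IsNat-p₁ 3F 3F = total⇒IsNat 3F 3F 1F D (count⇒total cycD (balance cycD
        (solve 6 (λ a b c d G H → Symbolic.balance′ a b c d (:- c) G H 3F 3F 1F cycD) refl a b c d G H)) 16D)
      IsNat-p₁ 3F 4F = total⇒IsNat 3F 4F 1F B (count⇒total cycB (balance cycB
        (solve 6 (λ a b c d G H → Symbolic.balance′ a b c d (:- c) G H 3F 4F 1F cycB) refl a b c d G H)) 16B)
      IsNat-p₁ 4F 0F = IsNat-swap 0F 4F 1F (IsNat-p₀₁ 4F)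
      IsNat-p₁ 4F 1F = IsNat-swap 1F 4F 1F (IsNat-p₁ 1F 4F)
      IsNat-p₁ 4F 2F = IsNat-swap 2F 4F 1F (IsNat-p₁ 2F 4F)
      IsNat-p₁ 4F 3F = IsNat-swap 3F 4F 1F (IsNat-p₁ 3F 4F)
      IsNat-p₁ 4F 4F = total⇒IsNat 4F 4F 1F C (count⇒total cycC (balance cycC
        (solve 6 (λ a b c d G H → Symbolic.balance′ a b c d (:- c) G H 4F 4F 1F cycC) refl a b c d G H)) 16C)

      private
        unrot : ∀ i j ℓ → IsNat (p (rot i) (rot j) (rot ℓ)) → IsNat (p i j ℓ)
        unrot i j ℓ = subst IsNat (p-rot i j ℓ)

        -- Since `rot` sends 3 to 1, 4 to 3 and 2 to 4, the indices are reached from 1 in the order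
        -- 3, 4, 2. The same order serves for j when ℓ = 0.
        IsNat-p₃ : ∀ i j → IsNat (p i j 3F)
        IsNat-p₃ i j = unrot i j 3F (IsNat-p₁ (rot i) (rot j))

        IsNat-p₄ : ∀ i j → IsNat (p i j 4F)
        IsNat-p₄ i j = unrot i j 4F (IsNat-p₃ (rot i) (rot j))

        IsNat-p₃₀ : ∀ i → IsNat (p i 3F 0F)
        IsNat-p₃₀ i = unrot i 3F 0F (IsNat-p₀ (rot i))

        IsNat-p₄₀ : ∀ i → IsNat (p i 4F 0F)
        IsNat-p₄₀ i = unrot i 4F 0F (IsNat-p₃₀ (rot i))

        IsNat-p₂₀ : ∀ i → IsNat (p i 2F 0F)
        IsNat-p₂₀ i = unrot i 2F 0F (IsNat-p₄₀ (rot i))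

      allNat : AllIntersectionNumbersNat n K K K K P
      allNat i  j  1F = IsNat-p₁ i j
      allNat i  j  2F = unrot i j 2F (IsNat-p₄ (rot i) (rot j))
      allNat i  j  3F = IsNat-p₃ i j
      allNat i  j  4F = IsNat-p₄ i j
      allNat i  1F 0F = IsNat-p₀ i
      allNat i  2F 0F = IsNat-p₂₀ i
      allNat i  3F 0F = IsNat-p₃₀ i
      allNat i  4F 0F = IsNat-p₄₀ i
      allNat 0F 0F 0F = IsNat₀₀₀
      allNat 1F 0F 0F = IsNat-swap 0F 1F 0F (IsNat-p₀ 0F)
      allNat 2F 0F 0F = IsNat-swap 0F 2F 0F (IsNat-p₂₀ 0F)
      allNat 3F 0F 0F = IsNat-swap 0F 3F 0F (IsNat-p₃₀ 0F)
      allNat 4F 0F 0F = IsNat-swap 0F 4F 0F (IsNat-p₄₀ 0F)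

  -- The three types for the parameters of C(q).

  module Conference (q : ℕ) (5≤q : 5 ℕ.≤ q) where
    n K : R
    n = fromℕ q
    K = half (n - 1#)

    n≡ιq : n ≡ ι (+ q)
    n≡ιq = fromℕ≡ι q

    n≢0 : n ≢ 0#
    n≢0 = helper 5≤q
      where
      helper : ∀ {q} → 5 ℕ.≤ q → fromℕ q ≢ 0#
      helper {suc q} _ e = ι[1+n]≢0 q (trans (sym (fromℕ≡ι (suc q))) e)

    K≢0 : K ≢ 0#
    K≢0 K≡0 = helper 5≤q (trans (sym (2half (n - 1#))) (trans (cong (2# *_) K≡0) (zeroʳ 2#)))
      where
      helper : ∀ {q} → 5 ℕ.≤ q → fromℕ q - 1# ≢ 0#
      helper {suc (suc q)} _ e = ι[1+n]≢0 q (begin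
        ι (+ suc q)                ≡⟨ fromℕ≡ι (suc q) ⟨
        fromℕ (suc q)              ≡⟨ solve 1 (λ x → x := con (+ 1) :+ x :- con (+ 1)) refl (fromℕ (suc q)) ⟩
        fromℕ (suc (suc q)) - 1#   ≡⟨ e ⟩
        0#                         ∎)
        where open ≡-Reasoning
      helper {suc zero} (s≤s ())

    n*K/K≡n : (n * K) / K ≡ n
    n*K/K≡n = trans (*-assoc n K (K ⁻¹)) (trans (cong (n *_) (⁻¹-inverse K K≢0)) (*-identityʳ n))

    half² : ∀ x → ι (+ 4) * (half x * half x) ≡ x * x
    half² x = trans (solve 1 (λ h → con (+ 4) :* (h :* h) := con (+ 2) :* h :* (con (+ 2) :* h)) refl (half x))
                    (cong₂ _*_ (2half x) (2half x))

    4≢0 : ι (+ 4) ≢ 0#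
    4≢0 = ι[1+n]≢0 3

    -- A is a square root of q of either sign. Replacing A by -A exchanges r and s, so both orders
    -- of the eigenvalues are covered.
    module Eigenvalues (A r s : R) (A²≡n : A * A ≡ n) (2r≡ : 2# * r ≡ - 1# + A) (2s≡ : 2# * s ≡ - 1# - A) where
      open ≡-Reasoning

      a b δ : R
      a = half r
      b = half s
      δ = a - b

      r+s≡-1 : r + s ≡ - 1#
      r+s≡-1 = *-cancelˡ-≢0 2≢0 (begin
        2# * (r + s)                 ≡⟨ distribˡ 2# r s ⟩
        2# * r + 2# * s              ≡⟨ cong₂ _+_ 2r≡ 2s≡ ⟩
        (- 1# + A) + (- 1# - A)
          ≡⟨ solve 1 (λ A → (:- con (+ 1) :+ A) :+ (:- con (+ 1) :- A) := con (+ 2) :* (:- con (+ 1))) refl A ⟩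
        2# * - 1#                    ∎)

      t≡s : - 1# - r ≡ s
      t≡s = trans (cong (_- r) (sym r+s≡-1)) (solve 2 (λ r s → r :+ s :- r := s) refl r s)

      u≡r : - 1# - s ≡ r
      u≡r = trans (cong (_- s) (sym r+s≡-1)) (solve 2 (λ r s → r :+ s :- s := r) refl r s)

      a+b : 1# ≡ - (2# * (a + b))
      a+b = begin
        1#                           ≡⟨ sym (-‿involutive 1#) ⟩
        - (- 1#)                     ≡⟨ cong (λ z → - z) (sym r+s≡-1) ⟩
        - (r + s)                    ≡⟨ cong₂ (λ x y → - (x + y)) (sym (2half r)) (sym (2half s)) ⟩
        - (2# * a + 2# * b)          ≡⟨ cong (λ z → - z) (sym (distribˡ 2# a b)) ⟩
        - (2# * (a + b))             ∎

      2δ≡A : 2# * δ ≡ A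
      2δ≡A = *-cancelˡ-≢0 2≢0 (begin
        2# * (2# * δ)
          ≡⟨ solve 2 (λ a b → con (+ 2) :* (con (+ 2) :* (a :- b))
               := con (+ 2) :* (con (+ 2) :* a) :- con (+ 2) :* (con (+ 2) :* b)) refl a b ⟩
        2# * (2# * a) - 2# * (2# * b) ≡⟨ cong₂ (λ x y → 2# * x - 2# * y) (2half r) (2half s) ⟩
        2# * r - 2# * s              ≡⟨ cong₂ _-_ 2r≡ 2s≡ ⟩
        (- 1# + A) - (- 1# - A)
          ≡⟨ solve 1 (λ A → (:- con (+ 1) :+ A) :- (:- con (+ 1) :- A) := con (+ 2) :* A) refl A ⟩
        2# * A                       ∎)

      n≡ : n ≡ 2# * 2# * (δ * δ)
      n≡ = begin
        n                            ≡⟨ sym A²≡n ⟩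
        A * A                        ≡⟨ cong₂ _*_ (sym 2δ≡A) (sym 2δ≡A) ⟩
        2# * δ * (2# * δ)
          ≡⟨ solve 1 (λ δ → con (+ 2) :* δ :* (con (+ 2) :* δ) := con (+ 2) :* con (+ 2) :* (δ :* δ)) refl δ ⟩
        2# * 2# * (δ * δ)            ∎

      δ≢0 : δ ≢ 0#
      δ≢0 δ≡0 = n≢0 (trans n≡ (trans (cong (λ z → 2# * 2# * (z * z)) δ≡0)
        (solve 0 (con (+ 2) :* con (+ 2) :* (con (+ 0) :* con (+ 0))
           := con (+ 0)) refl)))

      K/2≡ : half K ≡ - (2# * 2# * (a * b))
      K/2≡ = *-cancelˡ-≢0 4≢0 (begin
        ι (+ 4) * half K
          ≡⟨ solve 1 (λ k → con (+ 4) :* k := con (+ 2) :* (con (+ 2) :* k)) refl (half K) ⟩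
        2# * (2# * half K)           ≡⟨ trans (cong (2# *_) (2half K)) (2half (n - 1#)) ⟩
        n - 1#                       ≡⟨ solve 1 (λ n → n :- con (+ 1) := n :- con (+ 1) :* con (+ 1)) refl n ⟩
        n - 1# * 1#                  ≡⟨ cong₂ (λ x y → x - y * y) n≡ a+b ⟩
        2# * 2# * (δ * δ) - - (2# * (a + b)) * - (2# * (a + b))
          ≡⟨ solve 2 (λ a b →
               con (+ 2) :* con (+ 2) :* ((a :- b) :* (a :- b))
               :- (:- (con (+ 2) :* (a :+ b))) :* (:- (con (+ 2) :* (a :+ b)))
               := con (+ 4) :* (:- (con (+ 2) :* con (+ 2) :* (a :* b)))) refl a b ⟩
        ι (+ 4) * - (2# * 2# * (a * b)) ∎)

      norm⇐ : ∀ {y z} → y * y + z * z ≡ n → half y * half y + half z * half z ≡ δ * δ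
      norm⇐ {y} {z} e = *-cancelˡ-≢0 4≢0 (begin
        ι (+ 4) * (half y * half y + half z * half z)               ≡⟨ distribˡ _ _ _ ⟩
        ι (+ 4) * (half y * half y) + ι (+ 4) * (half z * half z)   ≡⟨ cong₂ _+_ (half² y) (half² z) ⟩
        y * y + z * z                                               ≡⟨ trans e n≡ ⟩
        2# * 2# * (δ * δ)
          ≡⟨ solve 1 (λ x → con (+ 2) :* con (+ 2) :* x := con (+ 4) :* x) refl (δ * δ) ⟩
        ι (+ 4) * (δ * δ)                                           ∎)

      -- The common form of the three types: w is 0 in type I, where also c = 0; it is `half sc` in
      -- type II, where d = 0; and it is -c in type III.
      record Shape (ρ σ τ ω : ℂ) : Set where
        field
          c d w : R
          ρ≡ : ρ ≡ (a , c)
          σ≡ : σ ≡ (b , d)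
          τ≡ : τ ≡ (b , d)
          ω≡ : ω ≡ (a , w)
          norm : c * c + d * d ≡ δ * δ
          wd : w * d ≡ - (c * d)

      private
        half0 : half 0# ≡ 0#
        half0 = zeroˡ _
        shapeI : ∀ {ρ σ τ ω} → TypeI n K K K K r s (- 1# - r) (- 1# - s) ρ σ τ ω → Shape ρ σ τ ω
        shapeI (sb , sz , sb² , sz² , refl , refl , refl , refl) = record
          { c = 0# ; d = half sb ; w = 0# ; ρ≡ = refl ; σ≡ = refl
          ; τ≡ = cong₂ (λ x y → half x , half y) t≡s (IsSqrt-unique sz² sb²)
          ; ω≡ = cong (λ x → half x , 0#) u≡r
          -- The vanishing imaginary part is rewritten as `half 0#` to fit `norm⇐`.
          ; norm = trans (cong (λ x → x * x + half sb * half sb) (sym half0))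
              (norm⇐ (trans (cong₂ _+_ (zeroˡ 0#) (trans (proj₂ sb²) n*K/K≡n)) (+-identityˡ n)))
          ; wd = solve 1 (λ d → con (+ 0) :* d := :- (con (+ 0) :* d)) refl (half sb) }

        shapeII : ∀ {ρ σ τ ω} → TypeII n K K K K r s (- 1# - r) (- 1# - s) ρ σ τ ω → Shape ρ σ τ ω
        shapeII (sy , sc , sy² , sc² , refl , refl , refl , refl) = record
          { c = half sy ; d = 0# ; w = half sc ; ρ≡ = refl ; σ≡ = refl
          ; τ≡ = cong (λ x → half x , 0#) t≡s
          ; ω≡ = cong (λ x → half x , half sc) u≡r
          ; norm = trans (cong (λ x → half sy * half sy + x * x) (sym half0))
              (norm⇐ (trans (cong₂ _+_ (trans (proj₂ sy²) n*K/K≡n) (zeroˡ 0#)) (+-identityʳ n)))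
          ; wd = solve 2 (λ c w → w :* con (+ 0) := :- (c :* con (+ 0))) refl (half sy) (half sc) }

        K-factor : ∀ {x y} → K * x + K * y ≡ n * K → x + y ≡ n
        K-factor {x} {y} e = *-cancelˡ-≢0 K≢0 (trans (distribˡ K x y) (trans e (*-comm n K)))

        shapeIII : ∀ {ρ σ τ ω} → TypeIII n K K K K r s (- 1# - r) (- 1# - s) ρ σ τ ω → Shape ρ σ τ ω
        shapeIII (β , γ , y , z , sb , sc , sy , sz , _ , _ , _ , _ , sb² , sc² , sy² , sz² ,
                  Ky+Kβ , Kz+Kγ , Ksysz , refl , refl , refl , refl) = record
          { c = half sy ; d = half sb ; w = - half sc ; ρ≡ = refl ; σ≡ = refl
          ; τ≡ = cong₂ (λ x y → half x , half y) t≡s sz≡sb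
          ; ω≡ = cong (λ x → half x , - half sc) u≡r
          ; norm = norm⇐ (trans (cong₂ _+_ (proj₂ sy²) (proj₂ sb²)) y+β≡n)
          ; wd = trans (sym (-‿distribˡ-* (half sc) (half sb))) (cong (λ x → - (half x * half sb)) sc≡sy) }
          where
          y+β≡n : y + β ≡ n
          y+β≡n = K-factor Ky+Kβ
          z+γ≡n : z + γ ≡ n
          z+γ≡n = K-factor Kz+Kγ
          square* : ∀ {x y u v} → x * x ≡ u → y * y ≡ v → x * y * (x * y) ≡ u * v
          square* {x} {y} refl refl = solve 2 (λ x y → x :* y :* (x :* y) := x :* x :* (y :* y)) refl x y
          yz≡βγ : y * z ≡ β * γ
          yz≡βγ = begin
            y * z                      ≡⟨ sym (square* (proj₂ sy²) (proj₂ sz²)) ⟩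
            sy * sz * (sy * sz)        ≡⟨ (let e = *-cancelˡ-≢0 K≢0 Ksysz in cong₂ _*_ e e) ⟩
            sb * sc * (sb * sc)        ≡⟨ square* (proj₂ sb²) (proj₂ sc²) ⟩
            β * γ                      ∎
          -- Here β and γ are the parameters b and c of type III. From y + β = z + γ = n and y z = β
          -- γ follows n z = y z + β z = β γ + β z = n β, so the two pairs coincide crosswise.
          z≡β : z ≡ β
          z≡β = *-cancelˡ-≢0 n≢0 (begin
            n * z                      ≡⟨ cong (_* z) (sym y+β≡n) ⟩
            (y + β) * z                ≡⟨ solve 3 (λ y β z → (y :+ β) :* z := y :* z :+ β :* z) refl y β z ⟩
            y * z + β * z              ≡⟨ cong (_+ β * z) yz≡βγ ⟩
            β * γ + β * z              ≡⟨ solve 3 (λ γ β z → β :* γ :+ β :* z := (z :+ γ) :* β) refl γ β z ⟩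
            (z + γ) * β                ≡⟨ cong (_* β) z+γ≡n ⟩
            n * β                      ∎)
          γ≡y : γ ≡ y
          γ≡y = begin
            γ                          ≡⟨ solve 2 (λ z γ → γ := z :+ γ :- z) refl z γ ⟩
            z + γ - z                  ≡⟨ cong₂ _-_ (trans z+γ≡n (sym y+β≡n)) z≡β ⟩
            y + β - β                  ≡⟨ solve 2 (λ y β → y :+ β :- β := y) refl y β ⟩
            y                          ∎
          sz≡sb : sz ≡ sb
          sz≡sb = square-injective (proj₁ sz²) (proj₁ sb²) (trans (proj₂ sz²) (trans z≡β (sym (proj₂ sb²))))
          sc≡sy : sc ≡ sy
          sc≡sy = square-injective (proj₁ sc²) (proj₁ sy²) (trans (proj₂ sc²) (trans γ≡y (sym (proj₂ sy²))))

      necessary : HasPutativeFission n K K K K r s (- 1# - r) (- 1# - s) →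
        (q ℕ.% 8 ≡ 5) × (∃[ g ] ∃[ h ] ((+ q ≡ g ℤ.* g ℤ.+ + 4 ℤ.* (h ℤ.* h)) × (∃[ w ] g ≡ + 1 ℤ.+ + 4 ℤ.* w)))
      necessary (ρ , σ , τ , ω , type , integral) =
        q%8≡5 , I.g , I.h , ι-injective (trans (sym n≡ιq) I.n≡g²+4h²) , I.w′ , refl
        where
        open Shape ([ shapeI , [ shapeII , shapeIII ]′ ]′ type)
        module I = ConferenceTable.Integrality n K a b c d w (2# * (c * c - d * d) / δ) (2# * (c * d) / δ)
          a+b n≡ K/2≡ norm (sym (*-/-cancel _ δ≢0)) (sym (*-/-cancel _ δ≢0)) wd n≢0 K≢0 δ≢0
          (subst (λ t → AllIntersectionNumbersNat n K K K K (mkP K K (a , c) (b , d) t (a , w))) τ≡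
            (subst₂ (λ x y → AllIntersectionNumbersNat n K K K K (mkP K K x y τ (a , w))) ρ≡ σ≡
              (subst (λ o → AllIntersectionNumbersNat n K K K K (mkP K K ρ σ τ o)) ω≡ integral)))
        q≡5+8e : q ≡ 5 ℕ.+ I.e ℕ.* 8
        q≡5+8e = ℤ.+-injective (ι-injective (trans (sym n≡ιq)
          (trans I.n≡8e+5 (cong (λ x → ι (+ 5 ℤ.+ x)) (sym (ℤ.pos-* I.e 8))))))
        q%8≡5 : q ℕ.% 8 ≡ 5
        q%8≡5 = trans (cong (ℕ._% 8) q≡5+8e) ([m+kn]%n≡m%n 5 I.e 8)

      -- Sufficiency: a type III table built from G and H.

      sufficient : ∀ {G H} → 0# ≤ A → 0# ≤ H → H ≢ 0# → n ≡ G * G + ι (+ 4) * (H * H) →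
        (V cA cB cC cD cE : ℕ) → half K ≡ ι (+ V) →
        ι (+ 16) * ι (+ cA) ≡ n + ι (ℤ.- + 7) + ι (+ 2) * G + ι (+ 0) * H →
        ι (+ 16) * ι (+ cB) ≡ n + ι (+ 1) + ι (+ 2) * G + ι (ℤ.- + 8) * H →
        ι (+ 16) * ι (+ cC) ≡ n + ι (+ 1) + ι (ℤ.- + 6) * G + ι (+ 0) * H →
        ι (+ 16) * ι (+ cD) ≡ n + ι (+ 1) + ι (+ 2) * G + ι (+ 8) * H →
        ι (+ 16) * ι (+ cE) ≡ n + ι (ℤ.- + 3) + ι (ℤ.- + 2) * G + ι (+ 0) * H →
        HasPutativeFission n K K K K r s (- 1# - r) (- 1# - s)
      sufficient {G} {H} 0≤A 0≤H H≢0 n≡G²+4H² V cA cB cC cD cE V≡ 16A 16B 16C 16D 16E =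
        (a , half y) , (b , half z) , (b , half z) , (a , - half y) ,
        inj₂ (inj₂ (Z , Y , Y , Z , z , y , y , z , 0<Z , 0<Y , 0<Y , 0<Z , z² , y² , y² , z² ,
          KY+KZ , trans (+-comm (K * Z) (K * Y)) KY+KZ , cong (K *_) (*-comm y z) ,
          refl , cong (λ x → half x , half z) (sym t≡s) , refl , cong (λ x → half x , - half y) (sym u≡r))) ,
        CyclicTable.allNat n K a b (half y) (half z) G H a+b n≡ K/2≡
          (norm⇐ (trans (cong₂ _+_ (proj₂ y²) (proj₂ z²)) Y+Z≡n)) G≡ H≡ n≢0 K≢0
          V cA cB cC cD cE V≡ 16A 16B 16C 16D 16E
        where
        -- These are 4 c² and 4 d², forced by Y + Z = n, which is the norm condition, and by Y - Z =
        -- A G, which defines G. Type III receives them crosswise: Y for its parameters c and y, Z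
        -- for b and z.
        Y Z : R
        Y = half (n + A * G)
        Z = half (n - A * G)

        Y+Z≡n : Y + Z ≡ n
        Y+Z≡n = *-cancelˡ-≢0 2≢0 (begin
          2# * (Y + Z)                   ≡⟨ distribˡ 2# Y Z ⟩
          2# * Y + 2# * Z                ≡⟨ cong₂ _+_ (2half _) (2half _) ⟩
          (n + A * G) + (n - A * G)
            ≡⟨ solve 2 (λ n x → (n :+ x) :+ (n :- x) := con (+ 2) :* n) refl n (A * G) ⟩
          2# * n                         ∎)

        Y-Z≡AG : Y - Z ≡ A * G
        Y-Z≡AG = *-cancelˡ-≢0 2≢0 (begin
          2# * (Y - Z)
            ≡⟨ solve 2 (λ y z → con (+ 2) :* (y :- z) := con (+ 2) :* y :- con (+ 2) :* z) refl Y Z ⟩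
          2# * Y - 2# * Z                ≡⟨ cong₂ _-_ (2half _) (2half _) ⟩
          (n + A * G) - (n - A * G)
            ≡⟨ solve 2 (λ n x → (n :+ x) :- (n :- x) := con (+ 2) :* x) refl n (A * G) ⟩
          2# * (A * G)                   ∎)

        -- Since A² = n and n - G² = 4 H², the difference is nonnegative, so |A G| ≤ n and neither Y
        -- nor Z is negative. It is also 4 Y Z, and H ≠ 0 makes it nonzero, so both are positive as
        -- type III demands.
        n²-[AG]² : n * n - A * G * (A * G) ≡ ι (+ 4) * (n * (H * H))
        n²-[AG]² = begin
          n * n - A * G * (A * G)
            ≡⟨ solve 3 (λ n A G → n :* n :- A :* G :* (A :* G) := n :* n :- A :* A :* (G :* G)) refl n A G ⟩
          n * n - A * A * (G * G)        ≡⟨ cong₂ (λ x y → n * x - y * (G * G)) n≡G²+4H² A²≡n ⟩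
          n * (G * G + ι (+ 4) * (H * H)) - n * (G * G)
                                         ≡⟨ solve 3 (λ n G H → n :* (G :+ con (+ 4) :* H) :- n :* G
                                              := con (+ 4) :* (n :* H)) refl n (G * G) (H * H) ⟩
          ι (+ 4) * (n * (H * H))        ∎

        YZ≡nH² : Y * Z ≡ n * (H * H)
        YZ≡nH² = *-cancelˡ-≢0 4≢0 (begin
          ι (+ 4) * (Y * Z)
            ≡⟨ solve 2 (λ y z → con (+ 4) :* (y :* z) := con (+ 2) :* y :* (con (+ 2) :* z)) refl Y Z ⟩
          2# * Y * (2# * Z)              ≡⟨ cong₂ _*_ (2half _) (2half _) ⟩
          (n + A * G) * (n - A * G)
            ≡⟨ solve 2 (λ n x → (n :+ x) :* (n :- x) := n :* n :- x :* x) refl n (A * G) ⟩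
          n * n - A * G * (A * G)        ≡⟨ n²-[AG]² ⟩
          ι (+ 4) * (n * (H * H))        ∎)

        YZ≢0 : Y * Z ≢ 0#
        YZ≢0 e = *-≢0 n≢0 (*-≢0 H≢0 H≢0) (trans (sym YZ≡nH²) e)

        0≤n : 0# ≤ n
        0≤n = subst (0# ≤_) A²≡n (0≤x² A)

        [AG]²≤n² : A * G * (A * G) ≤ n * n
        [AG]²≤n² = 0≤y-x⇒x≤y (subst (0# ≤_) (sym n²-[AG]²) (*-nonneg (0≤ι+ 4) (*-nonneg 0≤n (0≤x² H))))

        0≤2*⇒0≤ : ∀ {x} → 0# ≤ 2# * x → 0# ≤ x
        0≤2*⇒0≤ {x} p = *-cancelˡ-≤ 0<2 (subst (_≤ 2# * x) (sym (zeroʳ 2#)) p)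

        0<Y : 0# < Y
        0<Y = 0≤2*⇒0≤ (subst (0# ≤_)
                (trans (solve 2 (λ n x → n :- (:- x) := n :+ x) refl n (A * G)) (sym (2half _)))
                (x≤y⇒0≤y-x (square-cancel-≤ 0≤n
                  (subst (_≤ n * n) (solve 1 (λ x → x :* x := :- x :* :- x) refl (A * G)) [AG]²≤n²))))
            , λ e → YZ≢0 (trans (cong (_* Z) (sym e)) (zeroˡ Z))

        0<Z : 0# < Z
        0<Z = 0≤2*⇒0≤ (subst (0# ≤_) (sym (2half _)) (x≤y⇒0≤y-x (square-cancel-≤ 0≤n [AG]²≤n²)))
            , λ e → YZ≢0 (trans (cong (Y *_) (sym e)) (zeroʳ Y))

        y z : R
        y = proj₁ (sqrt (proj₁ 0<Y))
        z = proj₁ (sqrt (proj₁ 0<Z))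
        y² : IsSqrt y Y
        y² = proj₂ (sqrt (proj₁ 0<Y))
        z² : IsSqrt z Z
        z² = proj₂ (sqrt (proj₁ 0<Z))

        KY+KZ : K * Y + K * Z ≡ n * K
        KY+KZ = trans (sym (distribˡ K Y Z)) (trans (cong (K *_) Y+Z≡n) (*-comm K n))

        -- The squares agree by construction. The signs agree because A and H are both nonnegative,
        -- which is why the absolute value of h is used.
        yz≡AH : y * z ≡ A * H
        yz≡AH = square-injective (*-nonneg (proj₁ y²) (proj₁ z²)) (*-nonneg 0≤A 0≤H) (begin
          y * z * (y * z)
            ≡⟨ solve 2 (λ y z → y :* z :* (y :* z) := y :* y :* (z :* z)) refl y z ⟩
          y * y * (z * z)                ≡⟨ cong₂ _*_ (proj₂ y²) (proj₂ z²) ⟩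
          Y * Z                          ≡⟨ trans YZ≡nH² (cong (_* (H * H)) (sym A²≡n)) ⟩
          A * A * (H * H)
            ≡⟨ solve 2 (λ A H → A :* A :* (H :* H) := A :* H :* (A :* H)) refl A H ⟩
          A * H * (A * H)                ∎)

        G≡ : 2# * (half y * half y - half z * half z) ≡ δ * G
        G≡ = *-cancelˡ-≢0 2≢0 (begin
          2# * (2# * (half y * half y - half z * half z))
            ≡⟨ solve 2 (λ y z → con (+ 2) :* (con (+ 2) :* (y :- z))
                 := con (+ 4) :* y :- con (+ 4) :* z) refl (half y * half y) (half z * half z) ⟩
          ι (+ 4) * (half y * half y) - ι (+ 4) * (half z * half z)
            ≡⟨ cong₂ _-_ (trans (half² y) (proj₂ y²)) (trans (half² z) (proj₂ z²)) ⟩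
          Y - Z
            ≡⟨ trans Y-Z≡AG (cong (_* G) (sym 2δ≡A)) ⟩
          2# * δ * G
            ≡⟨ *-assoc 2# δ G ⟩
          2# * (δ * G) ∎)

        H≡ : 2# * (half y * half z) ≡ δ * H
        H≡ = *-cancelˡ-≢0 2≢0 (begin
          2# * (2# * (half y * half z))
            ≡⟨ solve 2 (λ y z → con (+ 2) :* (con (+ 2) :* (y :* z))
                 := con (+ 2) :* y :* (con (+ 2) :* z)) refl (half y) (half z) ⟩
          2# * half y * (2# * half z)
            ≡⟨ cong₂ _*_ (2half y) (2half z) ⟩
          y * z
            ≡⟨ trans yz≡AH (cong (_* H) (sym 2δ≡A)) ⟩
          2# * δ * H
            ≡⟨ *-assoc 2# δ H ⟩
          2# * (δ * H) ∎)

    -- The two implications for q itself.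

    ConferenceHasPutativeFission⇒q≡g²+4h² : ConferenceHasPutativeFission q →
      (q ℕ.% 8 ≡ 5) × (∃[ g ] ∃[ h ] ((+ q ≡ g ℤ.* g ℤ.+ + 4 ℤ.* (h ℤ.* h)) × (∃[ w ] g ≡ + 1 ℤ.+ + 4 ℤ.* w)))
    ConferenceHasPutativeFission⇒q≡g²+4h² (sq , (_ , sq²) , inj₁ fission) =
      Eigenvalues.necessary sq _ _ sq² (2half _) (2half _) fission
    ConferenceHasPutativeFission⇒q≡g²+4h² (sq , (_ , sq²) , inj₂ fission) =
      Eigenvalues.necessary (- sq) _ _ (trans (solve 1 (λ x → :- x :* :- x := x :* x) refl sq) sq²)
        (2half _) (trans (2half _) (cong (λ z → - 1# + z) (sym (-‿involutive sq)))) fission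

    infix 4 _↦_
    -- A record and not a bare equation, so that m and x stay visible to unification although
    -- `ι (+ m)` unfolds.
    record _↦_ (m : ℕ) (x : R) : Set where
      constructor image
      field ι≡ : ι (+ m) ≡ x
    open _↦_

    ↦-ι : ∀ {m} → m ↦ ι (+ m)
    ↦-ι = image refl

    ↦-+ : ∀ {i j x y} → i ↦ x → j ↦ y → i ℕ.+ j ↦ x + y
    ↦-+ {i} {j} (image refl) (image refl) = image (ι-+ (+ i) (+ j))

    ↦-* : ∀ {i j x y} → i ↦ x → j ↦ y → i ℕ.* j ↦ x * y
    ↦-* {i} {j} (image refl) (image refl) = image (trans (cong ι (ℤ.pos-* i j)) (ι-* (+ i) (+ j)))

    q≡g²+4h²⇒ConferenceHasPutativeFission : q ℕ.% 8 ≡ 5 → ∀ w h →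
      + q ≡ (+ 1 ℤ.+ + 4 ℤ.* w) ℤ.* (+ 1 ℤ.+ + 4 ℤ.* w) ℤ.+ + 4 ℤ.* (h ℤ.* h) → ConferenceHasPutativeFission q
    q≡g²+4h²⇒ConferenceHasPutativeFission q%8≡5 w h q≡ =
      proj₁ √n , proj₂ √n , inj₁ (Eigenvalues.sufficient (proj₁ √n) _ _ (proj₂ (proj₂ √n)) (2half _) (2half _)
        (proj₁ (proj₂ √n)) 0≤H H≢0 n≡G²+4H²
        -- (q - 1) / 4 = 1 + 2 e, followed by A = w² + w + v² + v, B = w² + w + v², C = w² - w + v²
        -- + v, D = w² + w + (v + 1)² and E = w² + v² + v. They come from g = 1 + 4 w and |h| = 1 +
        -- 2 v; `pronic` makes w² ± w natural even for negative w.
        (1 ℕ.+ e ℕ.* 2)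
        (k ℕ.+ (v ℕ.* v ℕ.+ v)) (k ℕ.+ v ℕ.* v) (l ℕ.+ (v ℕ.* v ℕ.+ v)) (k ℕ.+ (v ℕ.+ 1) ℕ.* (v ℕ.+ 1))
        (ℤ.∣ w ∣ ℕ.* ℤ.∣ w ∣ ℕ.+ (v ℕ.* v ℕ.+ v))
        K/2≡1+2e
        (sixteen (ℤ.- + 7) (+ 2) (+ 0) (↦-+ ιk v²+v)
          (solve 2 (λ W V → con (+ 16) :* ((W :* W :+ W) :+ (V :* V :+ V))
               := count W V (ℤ.- + 7) (+ 2) (+ 0)) refl W V))
        (sixteen (+ 1) (+ 2) (ℤ.- + 8) (↦-+ ιk (↦-* {v} ↦-ι ↦-ι))
          (solve 2 (λ W V → con (+ 16) :* ((W :* W :+ W) :+ V :* V)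
               := count W V (+ 1) (+ 2) (ℤ.- + 8)) refl W V))
        (sixteen (+ 1) (ℤ.- + 6) (+ 0) (↦-+ ιl v²+v)
          (solve 2 (λ W V → con (+ 16) :* ((:- W :* :- W :+ :- W) :+ (V :* V :+ V))
               := count W V (+ 1) (ℤ.- + 6) (+ 0)) refl W V))
        (sixteen (+ 1) (+ 2) (+ 8) (↦-+ ιk (↦-* v+1 v+1))
          (solve 2 (λ W V → con (+ 16) :* ((W :* W :+ W) :+ (V :+ con (+ 1)) :* (V :+ con (+ 1)))
               := count W V (+ 1) (+ 2) (+ 8)) refl W V))
        (sixteen (ℤ.- + 3) (ℤ.- + 2) (+ 0) (↦-+ ιw² v²+v)
          (solve 2 (λ W V → con (+ 16) :* (W :* W :+ (V :* V :+ V))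
               := count W V (ℤ.- + 3) (ℤ.- + 2) (+ 0)) refl W V)))
      where
      open ≡-Reasoning
      √n : ∃[ x ] IsSqrt x n
      √n = sqrt (subst (0# ≤_) (sym n≡ιq) (0≤ι+ q))

      e k l v : ℕ
      e = q ℕ./ 8
      k = proj₁ (pronic w)
      l = proj₁ (pronic (ℤ.- w))
      v = proj₁ (q%8≡5⇒h-odd q w h q%8≡5 q≡)

      W V G H : R
      W = ι w
      V = ι (+ v)
      G = 1# + ι (+ 4) * W
      H = 1# + 2# * V

      v+1 : v ℕ.+ 1 ↦ V + 1#
      v+1 = ↦-+ {v} {1} ↦-ι ↦-ι

      v²+v : v ℕ.* v ℕ.+ v ↦ V * V + V
      v²+v = ↦-+ (↦-* {v} ↦-ι ↦-ι) ↦-ι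

      ι-pronic : ∀ i → ι (+ proj₁ (pronic i)) ≡ ι i * ι i + ι i
      ι-pronic i = trans (cong ι (proj₂ (pronic i))) (trans (ι-+ (i ℤ.* i) i) (cong (_+ ι i) (ι-* i i)))

      ιk : k ↦ W * W + W
      ιk = image (ι-pronic w)

      ιl : l ↦ - W * - W + - W
      ιl = image (trans (ι-pronic (ℤ.- w)) (cong (λ x → x * x + x) (ι-neg w)))

      ιw² : ℤ.∣ w ∣ ℕ.* ℤ.∣ w ∣ ↦ W * W
      ιw² = image (trans (cong ι (sym (square-abs w))) (ι-* w w))

      H≡ι : H ≡ ι (+ suc (2 ℕ.* v))
      H≡ι = sym (ι≡ (↦-+ {1} ↦-ι (↦-* {2} {v} ↦-ι ↦-ι)))

      0≤H : 0# ≤ H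
      0≤H = subst (0# ≤_) (sym H≡ι) (0≤ι+ (suc (2 ℕ.* v)))

      H≢0 : H ≢ 0#
      H≢0 H≡0 = ι[1+n]≢0 (2 ℕ.* v) (trans (sym H≡ι) H≡0)

      n≡G²+4H² : n ≡ G * G + ι (+ 4) * (H * H)
      n≡G²+4H² = begin
        n                                              ≡⟨ trans n≡ιq (cong ι q≡) ⟩
        ι (g ℤ.* g ℤ.+ + 4 ℤ.* (h ℤ.* h))
          ≡⟨ trans (ι-+ (g ℤ.* g) _) (cong₂ _+_ (ι-* g g) (ι-* (+ 4) (h ℤ.* h))) ⟩
        ι g * ι g + ι (+ 4) * ι (h ℤ.* h)              ≡⟨ cong₂ (λ x y → x * x + ι (+ 4) * y) ιg ιh² ⟩
        G * G + ι (+ 4) * (H * H)                      ∎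
        where
        g = + 1 ℤ.+ + 4 ℤ.* w
        ιg : ι g ≡ G
        ιg = trans (ι-+ (+ 1) (+ 4 ℤ.* w)) (cong (λ x → 1# + x) (ι-* (+ 4) w))
        ιh² : ι (h ℤ.* h) ≡ H * H
        ιh² = trans (cong ι (square-abs h)) (ι≡ (↦-* ι∣h∣ ι∣h∣))
          where
          ι∣h∣ : ℤ.∣ h ∣ ↦ H
          ι∣h∣ = image (trans (cong (λ x → ι (+ x)) (proj₂ (q%8≡5⇒h-odd q w h q%8≡5 q≡))) (sym H≡ι))

      count : Polynomial 2 → Polynomial 2 → ℤ → ℤ → ℤ → Polynomial 2
      count W V α β γ = (G′ :* G′ :+ con (+ 4) :* (H′ :* H′)) :+ con α :+ con β :* G′ :+ con γ :* H′
        where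
        G′ = con (+ 1) :+ con (+ 4) :* W
        H′ = con (+ 1) :+ con (+ 2) :* V

      sixteen : ∀ α β γ {i x} → i ↦ x →
        ι (+ 16) * x ≡ (G * G + ι (+ 4) * (H * H)) + ι α + ι β * G + ι γ * H →
        ι (+ 16) * ι (+ i) ≡ n + ι α + ι β * G + ι γ * H
      sixteen α β γ {i} {x} (image i≡) e = begin
        ι (+ 16) * ι (+ i)                                               ≡⟨ cong (ι (+ 16) *_) i≡ ⟩
        ι (+ 16) * x                                                     ≡⟨ e ⟩
        (G * G + ι (+ 4) * (H * H)) + ι α + ι β * G + ι γ * H
          ≡⟨ cong (λ m → m + ι α + ι β * G + ι γ * H) (sym n≡G²+4H²) ⟩
        n + ι α + ι β * G + ι γ * H                                      ∎

      K/2≡1+2e : half K ≡ ι (+ (1 ℕ.+ e ℕ.* 2))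
      K/2≡1+2e = *-cancelˡ-≢0 4≢0 (begin
        ι (+ 4) * half K
          ≡⟨ solve 1 (λ k → con (+ 4) :* k := con (+ 2) :* (con (+ 2) :* k)) refl (half K) ⟩
        2# * (2# * half K)                      ≡⟨ trans (cong (2# *_) (2half K)) (2half (n - 1#)) ⟩
        n - 1#                                  ≡⟨ cong (_- 1#) (trans n≡ιq (cong (λ x → ι (+ x)) q≡5+8e)) ⟩
        ι (+ (5 ℕ.+ e ℕ.* 8)) - 1#              ≡⟨ cong (_- 1#) (ι≡ (↦-+ {5} ↦-ι (↦-* {e} {8} ↦-ι ↦-ι))) ⟩
        ι (+ 5) + ι (+ e) * ι (+ 8) - 1#
          ≡⟨ solve 1 (λ e → con (+ 5) :+ e :* con (+ 8) :- con (+ 1)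
               := con (+ 4) :* (con (+ 1) :+ e :* con (+ 2))) refl (ι (+ e)) ⟩
        ι (+ 4) * (1# + ι (+ e) * 2#)
          ≡⟨ cong (ι (+ 4) *_) (sym (ι≡ (↦-+ {1} ↦-ι (↦-* {e} {2} ↦-ι ↦-ι)))) ⟩
        ι (+ 4) * ι (+ (1 ℕ.+ e ℕ.* 2))         ∎)
        where
        q≡5+8e : q ≡ 5 ℕ.+ e ℕ.* 8
        q≡5+8e = trans (m≡m%n+[m/n]*n q 8) (cong (ℕ._+ e ℕ.* 8) q%8≡5)

open import Data.Nat using (ℕ; _≤_; _%_)
open import Data.Integer using (ℤ; +_; _+_; _*_)
open import Data.Product using (_×_; ∃-syntax)
open import Function.Bundles using (_⇔_)
open import Relation.Binary.PropositionalEquality using (_≡_)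

theorem3p3 : (F : RealField) (q : ℕ) → 5 ≤ q → q % 4 ≡ 1 →
    Scheme.ConferenceHasPutativeFission F q ⇔
    ((q % 8 ≡ 5) × (∃[ g ] ∃[ h ] ((+ q ≡ g * g + + 4 * (h * h)) × (∃[ w ] g ≡ + 1 + + 4 * w))))
theorem3p3 F q 5≤q _ = mk⇔ ConferenceHasPutativeFission⇒q≡g²+4h²
  λ { (q%8≡5 , _ , h , q≡ , w , refl) → q≡g²+4h²⇒ConferenceHasPutativeFission q%8≡5 w h q≡ }
  where open Fission F
        open Conference q 5≤q
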